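{- Assume the following (two-phase conjecture): for all $p,x>0$ and all $n$, and for both the adaptive and the non-adaptive model, there is an optimal algorithm following a two-phase strategy. Then, without loss of generality, the optimal algorithm is postponing, in both the adaptive and the non-adaptive model: there is an optimal algorithm that executes every tested short job immediately after its test and executes all tested long jobs at the end of the schedule. In other words, for the adaptive game, $\mathrm{ratio}(c,d,e,f)=\mathrm{ratio}'(c,d,e,f)$ for every node with parameters $c,d,e,f$.
   Context: There are $n$ jobs to be scheduled on a single machine; the cost of a schedule is the sum of completion times. Each job is short (processing time $p$) or long (processing time $p+x$), with known $p,x>0$; which jobs are long is decided by an adversary and initially unknown to the algorithm. Jobs are handled in a fixed order. At any moment the algorithm can test the next job in this order (one time unit on the machine, revealing its processing time), execute the next job untested, or execute a previously tested job. The competitive ratio of a play is the cost of the resulting schedule divided by $\mathrm{OPT}=\bigl(p\,n(n+1)+x\,\ell(\ell+1)\bigr)/2$, where $\ell$ is the number of long jobs; the algorithm minimizes it, the adversary maximizes it. In the adaptive model the adversary reveals the length of a job when it is tested or executed, and both players may base decisions on the whole history; in the non-adaptive model the algorithm commits beforehand to which jobs are tested and which are executed untested, and the adversary then chooses all lengths. An optimal algorithm is one achieving the smallest competitive ratio against an optimally playing adversary. A two-phase strategy first tests some jobs and then executes all remaining jobs untested (once a job has been executed untested, no later job is tested). An algorithm is postponing if it executes all tested long jobs at the end of the schedule and every tested short job immediately after its test. Game tree of the adaptive game. The rank of an action (a test or an execution) is the number of jobs executed after it, including the job itself if the action is an execution. Consider a node where the algorithm is in turn and has not yet executed any untested job.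 Its parameters are: $c$, the number of tested short jobs; $d$, the number of tested long jobs which are pending (not yet executed); $f$, the number of untested jobs; and $e$, the total rank over all tests so far plus $x$ times the total rank of all executions of long tested jobs so far. $\mathrm{ratio}(c,d,e,f)$ is the competitive ratio reached from this node when both players play optimally without restriction, and $\mathrm{ratio}'(c,d,e,f)$ is the same when the algorithm is required to be postponing from there on. Explicitly, extending the notation to subsequent nodes ($c$ counting all short jobs revealed so far, and $e$ also including $x$ times the ranks of executions of long untested jobs, with $n$ fixed): at $f=0$ both values equal $$\frac{p\,n(n+1)/2+e+x\,d(d+1)/2}{p\,n(n+1)/2+x\,(n-c)(n-c+1)/2}.$$ For $f\ge1$, $\mathrm{ratio}'(c,d,e,f)$ is the minimum of $\max\{\mathrm{ratio}'(c+1,d,e+f+d,f-1),\ \mathrm{ratio}'(c,d+1,e+f+d,f-1)\}$ (testing the next job) and $\max\{\mathrm{ratio}'(c+1,d,e,f-1),\ \mathrm{ratio}'(c,d,e+x(f+d),f-1)\}$ (executing it untested). $\mathrm{ratio}$ satisfies the same recursion with $\mathrm{ratio}$ in place of $\mathrm{ratio}'$, and with the additional option $\mathrm{ratio}(c,d-1,e+x(f+d),f)$ in the minimum when $d\ge1$ (executing a pending tested long job). -}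

module Defs where

open import Algebra.Bundles using (CommutativeRing)
open import Algebra.Core using (Op₁; Op₂)
import Algebra.Construct.NaturalChoice.Max as Max
import Algebra.Construct.NaturalChoice.Min as Min
import Algebra.Definitions.RawMonoid as Multiples
open import Data.Fin.Base using (Fin; zero)
open import Data.List.Base using (List; []; _∷_; length; lookup; removeAt)
open import Data.Nat.Base as ℕ using (ℕ; zero; suc; _∸_)
open import Data.Product.Base using (_×_; ∃-syntax; Σ-syntax)
open import Data.Vec.Base using (Vec; []; _∷_)
open import Function.Base using (_∘_)
open import Level using (Level; _⊔_) renaming (suc to lsuc)
open import Relation.Binary.Bundles using (TotalOrder)
open import Relation.Binary.Core using (Rel)
import Relation.Binary.Construct.NonStrictToStrict as ToStrict
open import Relation.Binary.PropositionalEquality.Core using (_≡_)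
open import Relation.Binary.Structures using (IsDecTotalOrder)

private
  variable
    f : ℕ

-- Stands in for the real numbers, which the library lacks.  Classically ℝ is
-- an instance.  Inversion is total; nothing is assumed about 0# ⁻¹.
record OrderedField (c ℓ₁ ℓ₂ : Level) : Set (lsuc (c ⊔ ℓ₁ ⊔ ℓ₂)) where
  field
    commutativeRing : CommutativeRing c ℓ₁

  open CommutativeRing commutativeRing public

  infix 4 _≤_
  infix 8 _⁻¹
  field
    _≤_             : Rel Carrier ℓ₂
    _⁻¹             : Op₁ Carrier
    isDecTotalOrder : IsDecTotalOrder _≈_ _≤_
    0≉1             : 0# ≉ 1#
    ⁻¹-cong         : ∀ {a b} → a ≈ b → a ⁻¹ ≈ b ⁻¹
    ⁻¹-inverseʳ     : ∀ a → a ≉ 0# → a * a ⁻¹ ≈ 1#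
    +-monoʳ-≤       : ∀ a {b c} → b ≤ c → a + b ≤ a + c
    *-nonneg        : ∀ {a b} → 0# ≤ a → 0# ≤ b → 0# ≤ a * b

  open IsDecTotalOrder isDecTotalOrder public using (isTotalOrder)

  totalOrder : TotalOrder c ℓ₁ ℓ₂
  totalOrder = record { isTotalOrder = isTotalOrder }

  open ToStrict _≈_ _≤_ public using (_<_)
  open Min totalOrder public using () renaming (_⊓_ to min)
  open Max totalOrder public using () renaming (_⊔_ to max)
  open Multiples +-rawMonoid public using () renaming (_×_ to infixr 8 _·_)

  infixl 7 _/_
  _/_ : Op₂ Carrier
  a / b = a * b ⁻¹

data Length : Set where
  short long : Length

-- An algorithm, given as its decision tree: ps lists the revealed lengths of
-- the tested jobs not yet executed (most recently tested first; a job is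
-- identified by its position) and f counts the untested jobs.  A reply of the
-- adversary selects a subtree, so decisions depend on the whole history.
data Strategy : List Length → ℕ → Set where
  done     : Strategy [] 0
  test     : ∀ {ps} → ((l : Length) → Strategy (l ∷ ps) f) → Strategy ps (suc f)
  untested : ∀ {ps} → ((l : Length) → Strategy ps f) → Strategy ps (suc f)
  execute  : ∀ {ps} (i : Fin (length ps)) → Strategy (removeAt ps i) f → Strategy ps f

Algorithm : ℕ → Set
Algorithm n = Strategy [] n

data NoTest : ∀ {ps} → Strategy ps f → Set where
  done     : NoTest done
  untested : ∀ {ps} {k : Length → Strategy ps f} →
             (∀ l → NoTest (k l)) → NoTest (untested k)
  execute  : ∀ {ps} {i : Fin (length ps)} {σ : Strategy (removeAt ps i) f} →
             NoTest σ → NoTest (execute {ps = ps} i σ)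

data TwoPhase : ∀ {ps} → Strategy ps f → Set where
  done     : TwoPhase done
  test     : ∀ {ps} {k : (l : Length) → Strategy (l ∷ ps) f} →
             (∀ l → TwoPhase (k l)) → TwoPhase (test k)
  untested : ∀ {ps} {k : Length → Strategy ps f} →
             (∀ l → NoTest (k l)) → TwoPhase (untested k)
  execute  : ∀ {ps} {i : Fin (length ps)} {σ : Strategy (removeAt ps i) f} →
             TwoPhase σ → TwoPhase (execute {ps = ps} i σ)

-- Position zero after a test is the job just tested.  As short jobs leave at
-- once, the executions at f = 0 are those of the tested long jobs.
data Postponing : ∀ {ps} → Strategy ps f → Set where
  done     : Postponing done
  test     : ∀ {ps} {k : (l : Length) → Strategy (l ∷ ps) f} {σ : Strategy ps f} →
             k short ≡ execute zero σ → Postponing σ → Postponing (k long) →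
             Postponing (test k)
  untested : ∀ {ps} {k : Length → Strategy ps f} →
             (∀ l → Postponing (k l)) → Postponing (untested k)
  execute  : ∀ {ps} {i : Fin (length ps)} {σ : Strategy (removeAt ps i) 0} →
             Postponing σ → Postponing (execute {ps = ps} i σ)

data Decision : Set where
  test untested : Decision

-- Only the choice between testing and executing untested is fixed in advance;
-- when a tested job is executed may depend on the lengths revealed so far.
data Follows : ∀ {ps} → Vec Decision f → Strategy ps f → Set where
  done     : Follows [] done
  test     : ∀ {ps w} {k : (l : Length) → Strategy (l ∷ ps) f} →
             (∀ l → Follows w (k l)) → Follows (test ∷ w) (test k)
  untested : ∀ {ps w} {k : Length → Strategy ps f} →
             (∀ l → Follows w (k l)) → Follows (untested ∷ w) (untested k)
  execute  : ∀ {ps w} {i : Fin (length ps)} {σ : Strategy (removeAt ps i) f} →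
             Follows w σ → Follows w (execute {ps = ps} i σ)

NonAdaptive : ∀ {n} → Algorithm n → Set
NonAdaptive {n} σ = ∃[ w ] Follows {f = n} w σ

data Action : Set where
  test    : Action
  execute : Length → Action

Schedule : Set
Schedule = List Action

longJobs : Schedule → ℕ
longJobs []                 = 0
longJobs (test ∷ s)          = longJobs s
longJobs (execute short ∷ s) = longJobs s
longJobs (execute long ∷ s)  = suc (longJobs s)

run : ∀ {ps} → Strategy ps f → Vec Length f → Schedule
run done                 []       = []
run (test k)             (l ∷ ls) = test ∷ run (k l) ls
run (untested k)         (l ∷ ls) = execute l ∷ run (k l) ls
run (execute {ps = ps} i σ) ls    = execute (lookup ps i) ∷ run σ ls

module Game {k ℓ₁ ℓ₂} (K : OrderedField k ℓ₁ ℓ₂)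
            (p x : OrderedField.Carrier K) where
  open OrderedField K using (Carrier; _≤_; _+_; _/_; _·_; 0#; 1#; min; max)

  processingTime : Length → Carrier
  processingTime short = p
  processingTime long  = p + x

  -- Sum of completion times when the schedule starts at time t.
  costFrom : Carrier → Schedule → Carrier
  costFrom t []              = 0#
  costFrom t (test ∷ s)      = costFrom (t + 1#) s
  costFrom t (execute l ∷ s) = t + processingTime l + costFrom (t + processingTime l) s

  -- a m(m+1)/2
  tri : Carrier → ℕ → Carrier
  tri a m = (m ℕ.* suc m) · a / (2 · 1#)

  OPT : (n ℓ : ℕ) → Carrier
  OPT n ℓ = tri p n + tri x ℓ

  scheduleRatio : ℕ → Schedule → Carrier
  scheduleRatio n s = costFrom 0# s / OPT n (longJobs s)

  -- Largest value of v on the schedules that an adversary replying to each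
  -- test and each untested execution can force.
  worst : ∀ {ps} → Strategy ps f → (Schedule → Carrier) → Carrier
  worst done                    v = v []
  worst (test k)                v = max (worst (k short) (v ∘ (test ∷_)))
                                        (worst (k long)  (v ∘ (test ∷_)))
  worst (untested k)            v = max (worst (k short) (v ∘ (execute short ∷_)))
                                        (worst (k long)  (v ∘ (execute long ∷_)))
  worst (execute {ps = ps} i σ) v = worst σ (v ∘ (execute (lookup ps i) ∷_))

  adaptiveRatio : ∀ {n} → Algorithm n → Carrier
  adaptiveRatio {n} σ = worst σ (scheduleRatio n)

  maxOverLengths : ∀ n → (Vec Length n → Carrier) → Carrier
  maxOverLengths zero    v = v []
  maxOverLengths (suc n) v = max (maxOverLengths n (v ∘ (short ∷_)))
                                 (maxOverLengths n (v ∘ (long ∷_)))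

  nonAdaptiveRatio : ∀ {n} → Algorithm n → Carrier
  nonAdaptiveRatio {n} σ = maxOverLengths n (scheduleRatio n ∘ run σ)

  AdaptiveOptimal : ∀ {n} → Algorithm n → Set ℓ₂
  AdaptiveOptimal {n} σ = (τ : Algorithm n) → adaptiveRatio σ ≤ adaptiveRatio τ

  NonAdaptiveOptimal : ∀ {n} → Algorithm n → Set ℓ₂
  NonAdaptiveOptimal {n} σ =
    NonAdaptive σ ×
    ((τ : Algorithm n) → NonAdaptive τ → nonAdaptiveRatio σ ≤ nonAdaptiveRatio τ)

  module GameTree (n : ℕ) where

    leafRatio : (c d : ℕ) (e : Carrier) → Carrier
    leafRatio c d e = (tri p n + e + tri x d) / OPT n (n ∸ c)

    ratio′ : (c d : ℕ) (e : Carrier) (f : ℕ) → Carrier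
    ratio′ c d e zero    = leafRatio c d e
    ratio′ c d e (suc f) =
      min (max (ratio′ (suc c) d (e + (suc f ℕ.+ d) · 1#) f)
               (ratio′ c (suc d) (e + (suc f ℕ.+ d) · 1#) f))
          (max (ratio′ (suc c) d e f)
               (ratio′ c d (e + (suc f ℕ.+ d) · x) f))

    ratio : (c d : ℕ) (e : Carrier) (f : ℕ) → Carrier
    ratio c d e zero = leafRatio c d e
    ratio c zero e (suc f) =
      min (max (ratio (suc c) 0 (e + (suc f ℕ.+ 0) · 1#) f)
               (ratio c 1 (e + (suc f ℕ.+ 0) · 1#) f))
          (max (ratio (suc c) 0 e f)
               (ratio c 0 (e + (suc f ℕ.+ 0) · x) f))
    ratio c (suc d) e (suc f) =
      min (min (max (ratio (suc c) (suc d) (e + (suc f ℕ.+ suc d) · 1#) f)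
                    (ratio c (suc (suc d)) (e + (suc f ℕ.+ suc d) · 1#) f))
               (max (ratio (suc c) (suc d) e f)
                    (ratio c (suc d) (e + (suc f ℕ.+ suc d) · x) f)))
          (ratio c d (e + (suc f ℕ.+ suc d) · x) (suc f))

    -- The parameters of the nodes reachable from the root, including those
    -- after an untested execution.
    data Node : (c d : ℕ) (e : Carrier) (f : ℕ) → Set k where
      root          : Node 0 0 0# n
      testShort     : ∀ {c d e f} → Node c d e (suc f) →
                      Node (suc c) d (e + (suc f ℕ.+ d) · 1#) f
      testLong      : ∀ {c d e f} → Node c d e (suc f) →
                      Node c (suc d) (e + (suc f ℕ.+ d) · 1#) f
      untestedShort : ∀ {c d e f} → Node c d e (suc f) → Node (suc c) d e f
      untestedLong  : ∀ {c d e f} → Node c d e (suc f) →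
                      Node c d (e + (suc f ℕ.+ d) · x) f
      executeLong   : ∀ {c d e f} → Node c (suc d) e f →
                      Node c d (e + (f ℕ.+ suc d) · x) f

TwoPhaseConjecture : ∀ {c ℓ₁ ℓ₂} → OrderedField c ℓ₁ ℓ₂ → Set (c ⊔ ℓ₁ ⊔ ℓ₂)
TwoPhaseConjecture K =
  ∀ p x → 0# < p → 0# < x → ∀ n →
  let open Game K p x in
  (Σ[ σ ∈ Algorithm n ] TwoPhase σ × AdaptiveOptimal σ) ×
  (Σ[ σ ∈ Algorithm n ] TwoPhase σ × NonAdaptiveOptimal σ)
  where open OrderedField K using (0#; _<_)

{-# OPTIONS --safe #-}

-- Adaptive model.  Executing a pending long job while untested jobs remain is
-- never better than executing the next job untested: if that job is long, the
-- pending job can play its role in the rest of the game, and if it is short,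
-- revealing it after the pending job only costs more.  So the additional
-- option of ratio is redundant at every node, whatever is conjectured.
--
-- Non-adaptive model.  The conjecture yields a strategy that tests a jobs and
-- then executes b jobs untested.  Let r be its ratio and consider the
-- adversary who reveals k long jobs before t short jobs among the tested ones
-- and m long jobs before s short jobs among the others.  It forces a delay
-- over OPT of at least lowerExcess, in which each pending long job costs the
-- cheaper of being kept and of being executed at once, whereas the postponing
-- strategy has at most upperExcess, in which all are kept.  If upperExcess is
-- too large for r, then keeping was not the cheaper choice for some (k,t,m,s),
-- so s is small there; comparing lengths then shows that lowerExcess is within
-- the bound for r with a − 1 tests as well.  Descending in a, one reaches a
-- number of tests for which the postponing strategy has ratio at most r.

module Submission where

open import Defs
import Algebra.Construct.NaturalChoice.Max as Max
import Algebra.Construct.NaturalChoice.Min as Min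
import Algebra.Properties.Ring as RingProperties
import Algebra.Properties.Semiring.Mult as Mult
import Algebra.Solver.CommutativeMonoid as MonoidSolver
open import Data.Fin.Base using (zero; suc)
open import Data.List.Base using (List; []; _∷_; length; lookup; removeAt; replicate)
open import Data.List.Properties using (length-removeAt′; length-replicate)
open import Data.Nat.Base as ℕ using (ℕ; zero; suc; z≤n; s≤s; _∸_)
open import Data.Nat.Properties as ℕ using ()
open import Algebra.Properties.CommutativeSemigroup ℕ.+-commutativeSemigroup
  using () renaming (interchange to +-interchange)
open import Data.Nat.Tactic.RingSolver using (solve-∀)
open import Data.Product.Base using (_×_; _,_; proj₁; proj₂; ∃-syntax; Σ-syntax)
open import Data.Sum.Base using (_⊎_; inj₁; inj₂; [_,_]′)
open import Data.Vec.Base using (Vec; []; _∷_; toList)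
open import Function.Base using (_∘_)
open import Level using (_⊔_)
open import Relation.Binary.Bundles using (TotalOrder)
import Relation.Binary.Reasoning.PartialOrder as PartialOrderReasoning
open import Relation.Binary.PropositionalEquality.Core as ≡ using (_≡_)
open import Relation.Binary.Structures using (IsDecTotalOrder)
open import Relation.Nullary.Decidable.Core using (Dec; yes; no)
open import Relation.Nullary.Negation.Core using (¬_; contradiction)

private
  variable
    f : ℕ

-- Arithmetic in ordered fields.

Positive : ∀ {c ℓ₁ ℓ₂} (K : OrderedField c ℓ₁ ℓ₂) → OrderedField.Carrier K → Set (ℓ₁ ⊔ ℓ₂)
Positive K a = 0# < a
  where open OrderedField K

module OrderedFieldProperties {c ℓ₁ ℓ₂} (K : OrderedField c ℓ₁ ℓ₂) where
  open OrderedField K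
  open IsDecTotalOrder isDecTotalOrder public
    using (_≤?_; total)
    renaming (refl to ≤-refl; reflexive to ≤-reflexive; trans to ≤-trans; antisym to ≤-antisym)
  open Min totalOrder public
    using (x⊓y≤x; x⊓y≤y; ⊓-glb; ⊓-mono-≤; ⊓-cong; ⊓-sel; x≤y⇒x⊓y≈x)
  open Max totalOrder public
    using (x≤x⊔y; x≤y⊔x; ⊔-lub; ⊔-mono-≤; ⊔-cong)
  open Mult semiring public
    using () renaming
    (×-homo-+ to ·-homo-+; ×-assocˡ to ·-assocˡ; ×-congʳ to ·-congʳ; ×-congˡ to ·-congˡ; ×-assoc-* to ·-assoc-*)
  open RingProperties ring using (-‿distribˡ-*; -‿distribʳ-*; -‿involutive)
  open PartialOrderReasoning (TotalOrder.poset totalOrder) public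

  module +-Solver = MonoidSolver +-commutativeMonoid

  +-mono-≤ : ∀ {a b c d} → a ≤ b → c ≤ d → a + c ≤ b + d
  +-mono-≤ {a} {b} {c} {d} a≤b c≤d = begin
    a + c ≤⟨ +-monoʳ-≤ a c≤d ⟩
    a + d ≈⟨ +-comm a d ⟩
    d + a ≤⟨ +-monoʳ-≤ d a≤b ⟩
    d + b ≈⟨ +-comm d b ⟩
    b + d ∎

  +-monoˡ-≤ : ∀ c {a b} → a ≤ b → a + c ≤ b + c
  +-monoˡ-≤ c a≤b = +-mono-≤ a≤b ≤-refl

  +-cancelʳ-≤ : ∀ c {a b} → a + c ≤ b + c → a ≤ b
  +-cancelʳ-≤ c {a} {b} a+c≤b+c = begin
    a             ≈⟨ x+c-c≈x a ⟨
    a + c + - c   ≤⟨ +-monoˡ-≤ (- c) a+c≤b+c ⟩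
    b + c + - c   ≈⟨ x+c-c≈x b ⟩
    b             ∎
    where
    x+c-c≈x : ∀ x → x + c + - c ≈ x
    x+c-c≈x x = trans (+-assoc x c (- c)) (trans (+-congˡ (-‿inverseʳ c)) (+-identityʳ x))

  +-cancelˡ-≤ : ∀ c {a b} → c + a ≤ c + b → a ≤ b
  +-cancelˡ-≤ c {a} {b} c+a≤c+b = +-cancelʳ-≤ c (begin
    a + c ≈⟨ +-comm a c ⟩
    c + a ≤⟨ c+a≤c+b ⟩
    c + b ≈⟨ +-comm c b ⟩
    b + c ∎)

  x≤x+y : ∀ {x y} → 0# ≤ y → x ≤ x + y
  x≤x+y {x} {y} 0≤y = begin
    x      ≈⟨ +-identityʳ x ⟨
    x + 0# ≤⟨ +-monoʳ-≤ x 0≤y ⟩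
    x + y  ∎

  x≤y+x : ∀ {x y} → 0# ≤ y → x ≤ y + x
  x≤y+x {x} {y} 0≤y = ≤-trans (x≤x+y 0≤y) (≤-reflexive (+-comm x y))

  +-nonneg : ∀ {a b} → 0# ≤ a → 0# ≤ b → 0# ≤ a + b
  +-nonneg 0≤a 0≤b = ≤-trans 0≤a (x≤x+y 0≤b)

  0≤x⇒-x≤0 : ∀ {x} → 0# ≤ x → - x ≤ 0#
  0≤x⇒-x≤0 {x} 0≤x = +-cancelʳ-≤ x (begin
    - x + x ≈⟨ -‿inverseˡ x ⟩
    0#      ≤⟨ 0≤x ⟩
    x       ≈⟨ +-identityˡ x ⟨
    0# + x  ∎)

  x≤0⇒0≤-x : ∀ {x} → x ≤ 0# → 0# ≤ - x
  x≤0⇒0≤-x {x} x≤0 = +-cancelʳ-≤ x (begin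
    0# + x  ≈⟨ +-identityˡ x ⟩
    x       ≤⟨ x≤0 ⟩
    0#      ≈⟨ -‿inverseˡ x ⟨
    - x + x ∎)

  0≤1 : 0# ≤ 1#
  0≤1 with total 0# 1#
  ... | inj₁ 0≤1 = 0≤1
  ... | inj₂ 1≤0 = begin
    0#              ≤⟨ *-nonneg (x≤0⇒0≤-x 1≤0) (x≤0⇒0≤-x 1≤0) ⟩
    - 1# * - 1#     ≈⟨ -‿distribˡ-* 1# (- 1#) ⟨
    - (1# * - 1#)   ≈⟨ -‿cong (*-identityˡ (- 1#)) ⟩
    - - 1#          ≈⟨ -‿involutive 1# ⟩
    1#              ∎

  *-monoʳ-≤ : ∀ {c a b} → 0# ≤ c → a ≤ b → a * c ≤ b * c
  *-monoʳ-≤ {c} {a} {b} 0≤c a≤b = +-cancelʳ-≤ (- a * c) (begin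
    a * c + - a * c  ≈⟨ distribʳ c a (- a) ⟨
    (a + - a) * c    ≈⟨ *-congʳ (-‿inverseʳ a) ⟩
    0# * c           ≈⟨ zeroˡ c ⟩
    0#               ≤⟨ *-nonneg 0≤b-a 0≤c ⟩
    (b + - a) * c    ≈⟨ distribʳ c b (- a) ⟩
    b * c + - a * c  ∎)
    where
    0≤b-a : 0# ≤ b + - a
    0≤b-a = begin
      0#      ≈⟨ -‿inverseʳ a ⟨
      a + - a ≤⟨ +-monoˡ-≤ (- a) a≤b ⟩
      b + - a ∎

  ⁻¹-nonneg : ∀ {a} → 0# < a → 0# ≤ a ⁻¹
  ⁻¹-nonneg {a} (0≤a , 0≉a) with total 0# (a ⁻¹)
  ... | inj₁ 0≤a⁻¹ = 0≤a⁻¹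
  ... | inj₂ a⁻¹≤0 = contradiction (≤-antisym 0≤1 (begin
    1#                ≈⟨ -‿involutive 1# ⟨
    - - 1#            ≈⟨ -‿cong (-‿cong (⁻¹-inverseʳ a (λ a≈0 → 0≉a (sym a≈0)))) ⟨
    - - (a * a ⁻¹)    ≈⟨ -‿cong (-‿distribʳ-* a (a ⁻¹)) ⟩
    - (a * (- (a ⁻¹)))    ≤⟨ 0≤x⇒-x≤0 (*-nonneg 0≤a (x≤0⇒0≤-x a⁻¹≤0)) ⟩
    0#                ∎)) 0≉1

  /-monoˡ-≤ : ∀ {a b c} → 0# < c → a ≤ b → a / c ≤ b / c
  /-monoˡ-≤ 0<c = *-monoʳ-≤ (⁻¹-nonneg 0<c)

  *-/-cancel : ∀ {a c} → 0# < c → a / c * c ≈ a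
  *-/-cancel {a} {c} (_ , 0≉c) = begin-equality
    a * c ⁻¹ * c    ≈⟨ *-assoc a (c ⁻¹) c ⟩
    a * (c ⁻¹ * c)  ≈⟨ *-congˡ (*-comm (c ⁻¹) c) ⟩
    a * (c * c ⁻¹)  ≈⟨ *-congˡ (⁻¹-inverseʳ c (λ c≈0 → 0≉c (sym c≈0))) ⟩
    a * 1#          ≈⟨ *-identityʳ a ⟩
    a               ∎

  /-*-cancel : ∀ {a c} → 0# < c → a * c / c ≈ a
  /-*-cancel {a} {c} (_ , 0≉c) = begin-equality
    a * c * c ⁻¹    ≈⟨ *-assoc a c (c ⁻¹) ⟩
    a * (c * c ⁻¹)  ≈⟨ *-congˡ (⁻¹-inverseʳ c (λ c≈0 → 0≉c (sym c≈0))) ⟩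
    a * 1#          ≈⟨ *-identityʳ a ⟩
    a               ∎

  /≤⇒≤* : ∀ {a b c} → 0# < c → a / c ≤ b → a ≤ b * c
  /≤⇒≤* {a} {b} {c} 0<c a/c≤b = begin
    a          ≈⟨ *-/-cancel 0<c ⟨
    a / c * c  ≤⟨ *-monoʳ-≤ (proj₁ 0<c) a/c≤b ⟩
    b * c      ∎

  ≤*⇒/≤ : ∀ {a b c} → 0# < c → a ≤ b * c → a / c ≤ b
  ≤*⇒/≤ {a} {b} {c} 0<c a≤bc = begin
    a / c      ≤⟨ /-monoˡ-≤ 0<c a≤bc ⟩
    b * c / c  ≈⟨ /-*-cancel 0<c ⟩
    b          ∎

  <-+-nonneg : ∀ {a b} → 0# < a → 0# ≤ b → 0# < a + b
  <-+-nonneg {a} {b} (0≤a , 0≉a) 0≤b =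
    +-nonneg 0≤a 0≤b ,
    λ 0≈a+b → 0≉a (≤-antisym 0≤a (≤-trans (x≤x+y 0≤b) (≤-reflexive (sym 0≈a+b))))

  ·-nonneg : ∀ n {a} → 0# ≤ a → 0# ≤ n · a
  ·-nonneg zero    0≤a = ≤-refl
  ·-nonneg (suc n) 0≤a = +-nonneg 0≤a (·-nonneg n 0≤a)

  ·-monoˡ-≤ : ∀ {m n a} → 0# ≤ a → m ℕ.≤ n → m · a ≤ n · a
  ·-monoˡ-≤ {n = n} 0≤a z≤n = ·-nonneg n 0≤a
  ·-monoˡ-≤         0≤a (s≤s m≤n) = +-monoʳ-≤ _ (·-monoˡ-≤ 0≤a m≤n)

  ·-monoʳ-≤ : ∀ n {a b} → a ≤ b → n · a ≤ n · b
  ·-monoʳ-≤ zero    a≤b = ≤-refl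
  ·-monoʳ-≤ (suc n) a≤b = +-mono-≤ a≤b (·-monoʳ-≤ n a≤b)

  ·-distribˡ-+ : ∀ n a b → n · (a + b) ≈ n · a + n · b
  ·-distribˡ-+ zero    a b = sym (+-identityˡ 0#)
  ·-distribˡ-+ (suc n) a b = trans (+-congˡ (·-distribˡ-+ n a b))
    (solve 4 (λ a b na nb → ((a ⊕ b) ⊕ (na ⊕ nb)) ⊜ ((a ⊕ na) ⊕ (b ⊕ nb))) refl a b (n · a) (n · b))
    where open +-Solver

  0<2 : 0# < 2 · 1#
  0<2 = <-+-nonneg (0≤1 , 0≉1) (·-nonneg 1 0≤1)

  ≤-+-⊓ : ∀ {a b c d} → a ≤ b + c → a ≤ b + d → a ≤ b + min c d
  ≤-+-⊓ {c = c} {d} a≤b+c a≤b+d with ⊓-sel c d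
  ... | inj₁ ⊓≈c = ≤-trans a≤b+c (≤-reflexive (+-congˡ (sym ⊓≈c)))
  ... | inj₂ ⊓≈d = ≤-trans a≤b+d (≤-reflexive (+-congˡ (sym ⊓≈d)))

-- Job counts, triangular numbers and postponing strategies.

longCount : Length → ℕ
longCount short = 0
longCount long  = 1

longs : List Length → ℕ
longs []       = 0
longs (l ∷ ps) = longCount l ℕ.+ longs ps

longs≤length : ∀ ps → longs ps ℕ.≤ length ps
longs≤length []           = z≤n
longs≤length (short ∷ ps) = ℕ.m≤n⇒m≤1+n (longs≤length ps)
longs≤length (long ∷ ps)  = s≤s (longs≤length ps)

longs-removeAt : ∀ ps i → longs ps ≡ longCount (lookup ps i) ℕ.+ longs (removeAt ps i)
longs-removeAt (l ∷ ps) zero    = ≡.refl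
longs-removeAt (l ∷ ps) (suc i) = ≡.trans (≡.cong (longCount l ℕ.+_) (longs-removeAt ps i))
  (eq (longCount l) (longCount (lookup ps i)) (longs (removeAt ps i)))
  where
  eq : ∀ a b c → a ℕ.+ (b ℕ.+ c) ≡ b ℕ.+ (a ℕ.+ c)
  eq = solve-∀

executions : Schedule → ℕ
executions []              = 0
executions (test ∷ s)      = executions s
executions (execute _ ∷ s) = suc (executions s)

executions-run : ∀ {ps} (σ : Strategy ps f) ls → executions (run σ ls) ≡ f ℕ.+ length ps
executions-run done               []       = ≡.refl
executions-run {suc f} (test k)   (l ∷ ls) = ≡.trans (executions-run (k l) ls) (ℕ.+-suc f _)
executions-run (untested k)       (l ∷ ls) = ≡.cong suc (executions-run (k l) ls)
executions-run {f} (execute {ps = ps} i σ) ls =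
  ≡.trans (≡.cong suc (executions-run σ ls))
    (≡.trans (≡.sym (ℕ.+-suc f _)) (≡.cong (f ℕ.+_) (≡.sym (length-removeAt′ ps i))))

-- The number m(m+1)/2 as a natural number, so that the division in `tri` is removed once and for
-- all by `tri≈triangle`.
triangle : ℕ → ℕ
triangle zero    = 0
triangle (suc m) = suc m ℕ.+ triangle m

triangle-double : ∀ m → m ℕ.* suc m ≡ 2 ℕ.* triangle m
triangle-double zero    = ≡.refl
triangle-double (suc m) = ≡.trans (eq₁ m) (≡.trans (≡.cong (2 ℕ.* suc m ℕ.+_) (triangle-double m))
  (≡.sym (ℕ.*-distribˡ-+ 2 (suc m) (triangle m))))
  where
  eq₁ : ∀ m → suc m ℕ.* suc (suc m) ≡ 2 ℕ.* suc m ℕ.+ m ℕ.* suc m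
  eq₁ = solve-∀

-- Only the choices between testing and executing untested: the postponing rule determines when
-- tested jobs are executed.
data Policy : ℕ → Set where
  done   : Policy 0
  decide : Decision → (Length → Policy f) → Policy (suc f)

-- Short jobs leave at once, so the pending list is always `replicate d long`, and removing position
-- zero computes to the right index.
postpone : ∀ d → Policy f → Strategy (replicate d long) f
postpone d       (decide test π)     = test λ where
  short → execute zero (postpone d (π short))
  long  → postpone (suc d) (π long)
postpone d       (decide untested π) = untested λ l → postpone d (π l)
postpone zero    done                = done
postpone (suc d) done                = execute zero (postpone d done)

postpone-postponing : ∀ d (π : Policy f) → Postponing (postpone d π)
postpone-postponing zero    done                = done
postpone-postponing (suc d) done                = execute (postpone-postponing d done)
postpone-postponing d       (decide test π)     =
  test ≡.refl (postpone-postponing d (π short)) (postpone-postponing (suc d) (π long))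
postpone-postponing d       (decide untested π) = untested λ l → postpone-postponing d (π l)

executions-postpone : ∀ d (π : Policy f) ls → executions (run (postpone d π) ls) ≡ f ℕ.+ d
executions-postpone {f} d π ls =
  ≡.trans (executions-run (postpone d π) ls) (≡.cong (f ℕ.+_) (length-replicate d))

-- The moves of the game preserve the total `n` of `ℓ` executed long, `d` pending long, `f` untested
-- and `c` revealed short jobs.
total-short : ∀ ℓ d f c → ℓ ℕ.+ d ℕ.+ f ℕ.+ suc c ≡ ℓ ℕ.+ d ℕ.+ suc f ℕ.+ c
total-short = solve-∀

total-testLong : ∀ ℓ d f c → ℓ ℕ.+ suc d ℕ.+ f ℕ.+ c ≡ ℓ ℕ.+ d ℕ.+ suc f ℕ.+ c
total-testLong = solve-∀

total-untestedLong : ∀ ℓ d f c → suc ℓ ℕ.+ d ℕ.+ f ℕ.+ c ≡ ℓ ℕ.+ d ℕ.+ suc f ℕ.+ c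
total-untestedLong = solve-∀

total-executeLong : ∀ ℓ d f c → suc ℓ ℕ.+ d ℕ.+ f ℕ.+ c ≡ ℓ ℕ.+ suc d ℕ.+ f ℕ.+ c
total-executeLong = solve-∀

-- The cost of a schedule in terms of ranks.

module Delay {c ℓ₁ ℓ₂} (K : OrderedField c ℓ₁ ℓ₂)
  (p x : OrderedField.Carrier K) (0<p : Positive K p) (0<x : Positive K x) where
  open OrderedField K hiding (zero)
  open OrderedFieldProperties K
  open Game K p x

  0≤p : 0# ≤ p
  0≤p = proj₁ 0<p

  0≤x : 0# ≤ x
  0≤x = proj₁ 0<x

  tri≈triangle : ∀ a m → tri a m ≈ triangle m · a
  tri≈triangle a m = begin-equality
    (m ℕ.* suc m) · a / (2 · 1#)                ≈⟨ *-congʳ (·-congˡ (triangle-double m)) ⟩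
    (2 ℕ.* triangle m) · a / (2 · 1#)           ≈⟨ *-congʳ (·-assocˡ a 2 (triangle m)) ⟨
    (2 · triangle m · a) / (2 · 1#)             ≈⟨ *-congʳ (·-congʳ 2 (*-identityˡ _)) ⟨
    (2 · (1# * triangle m · a)) / (2 · 1#)      ≈⟨ *-congʳ (·-assoc-* 2 1# _) ⟨
    2 · 1# * triangle m · a / (2 · 1#)          ≈⟨ *-congʳ (*-comm _ _) ⟩
    triangle m · a * 2 · 1# / (2 · 1#)          ≈⟨ /-*-cancel 0<2 ⟩
    triangle m · a                              ∎

  tri-suc : ∀ a m → tri a (suc m) ≈ suc m · a + tri a m
  tri-suc a m = begin-equality
    tri a (suc m)                  ≈⟨ tri≈triangle a (suc m) ⟩
    triangle (suc m) · a           ≈⟨ ·-homo-+ a (suc m) (triangle m) ⟩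
    suc m · a + triangle m · a     ≈⟨ +-congˡ (tri≈triangle a m) ⟨
    suc m · a + tri a m            ∎

  tri-nonneg : ∀ {a} m → 0# ≤ a → 0# ≤ tri a m
  tri-nonneg {a} m 0≤a = ≤-trans (·-nonneg (triangle m) 0≤a) (≤-reflexive (sym (tri≈triangle a m)))

  0<OPT : ∀ n ℓ → 0# < OPT (suc n) ℓ
  0<OPT n ℓ = <-resp-≈ (+-congʳ (sym (tri≈triangle p (suc n))))
    (<-+-nonneg (<-+-nonneg 0<p (·-nonneg (n ℕ.+ triangle n) 0≤p)) (tri-nonneg ℓ 0≤x))
    where
    <-resp-≈ : ∀ {a b} → a ≈ b → 0# < a → 0# < b
    <-resp-≈ a≈b (0≤a , 0≉a) = ≤-trans 0≤a (≤-reflexive a≈b) , λ 0≈b → 0≉a (trans 0≈b (sym a≈b))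

  -- Total rank of the tests plus `x` times the total rank of the long executions, which is what `e`
  -- accumulates in the game tree.
  delay : Schedule → Carrier
  delay []                  = 0#
  delay (test ∷ s)          = executions s · 1# + delay s
  delay (execute short ∷ s) = delay s
  delay (execute long ∷ s)  = suc (executions s) · x + delay s

  -- Double counting: each unit of machine time is paid once for every job that completes after it.
  costFrom≈ : ∀ t s → costFrom t s ≈ executions s · t + (tri p (executions s) + delay s)
  costFrom≈ t [] = begin-equality
    0#                    ≈⟨ tri≈triangle p 0 ⟨
    tri p 0               ≈⟨ +-identityʳ _ ⟨
    tri p 0 + 0#          ≈⟨ +-identityˡ _ ⟨
    0# + (tri p 0 + 0#)   ∎
  costFrom≈ t (test ∷ s) = begin-equality
    costFrom (t + 1#) s                             ≈⟨ costFrom≈ (t + 1#) s ⟩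
    N · (t + 1#) + (tri p N + delay s)              ≈⟨ +-congʳ (·-distribˡ-+ N t 1#) ⟩
    N · t + N · 1# + (tri p N + delay s)            ≈⟨ solve 4 (λ a b c d → ((a ⊕ b) ⊕ (c ⊕ d)) ⊜ (a ⊕ (c ⊕ (b ⊕ d)))) refl
                                                         (N · t) (N · 1#) (tri p N) (delay s) ⟩
    N · t + (tri p N + (N · 1# + delay s))          ∎
    where
    open +-Solver
    N : ℕ
    N = executions s
  costFrom≈ t (execute short ∷ s) = begin-equality
    t + p + costFrom (t + p) s                      ≈⟨ +-congˡ (costFrom≈ (t + p) s) ⟩
    t + p + (N · (t + p) + (tri p N + delay s))     ≈⟨ +-congˡ (+-congʳ (·-distribˡ-+ N t p)) ⟩
    t + p + (N · t + N · p + (tri p N + delay s))   ≈⟨ solve 6 (λ t p nt np T D →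
                                                         ((t ⊕ p) ⊕ ((nt ⊕ np) ⊕ (T ⊕ D))) ⊜ ((t ⊕ nt) ⊕ (((p ⊕ np) ⊕ T) ⊕ D)))
                                                         refl t p (N · t) (N · p) (tri p N) (delay s) ⟩
    suc N · t + (suc N · p + tri p N + delay s)     ≈⟨ +-congˡ (+-congʳ (tri-suc p N)) ⟨
    suc N · t + (tri p (suc N) + delay s)           ∎
    where
    open +-Solver
    N : ℕ
    N = executions s
  costFrom≈ t (execute long ∷ s) = begin-equality
    t + (p + x) + costFrom (t + (p + x)) s
      ≈⟨ +-congˡ (costFrom≈ (t + (p + x)) s) ⟩
    t + (p + x) + (N · (t + (p + x)) + (tri p N + delay s))
      ≈⟨ +-congˡ (+-congʳ (trans (·-distribˡ-+ N t (p + x)) (+-congˡ (·-distribˡ-+ N p x)))) ⟩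
    t + (p + x) + (N · t + (N · p + N · x) + (tri p N + delay s))
      ≈⟨ solve 8 (λ t p x nt np nx T D →
           ((t ⊕ (p ⊕ x)) ⊕ ((nt ⊕ (np ⊕ nx)) ⊕ (T ⊕ D))) ⊜ ((t ⊕ nt) ⊕ (((p ⊕ np) ⊕ T) ⊕ ((x ⊕ nx) ⊕ D))))
           refl t p x (N · t) (N · p) (N · x) (tri p N) (delay s) ⟩
    suc N · t + (suc N · p + tri p N + (suc N · x + delay s))
      ≈⟨ +-congˡ (+-congʳ (tri-suc p N)) ⟨
    suc N · t + (tri p (suc N) + (suc N · x + delay s)) ∎
    where
    open +-Solver
    N : ℕ
    N = executions s

  cost-run : ∀ {n} (σ : Algorithm n) ls → costFrom 0# (run σ ls) ≈ tri p n + delay (run σ ls)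
  cost-run {n} σ ls = begin-equality
    costFrom 0# s                                              ≈⟨ costFrom≈ 0# s ⟩
    executions s · 0# + (tri p (executions s) + delay s)       ≈⟨ +-congʳ (·-zeroʳ (executions s)) ⟩
    0# + (tri p (executions s) + delay s)                      ≈⟨ +-identityˡ _ ⟩
    tri p (executions s) + delay s                             ≈⟨ +-congʳ (reflexive (≡.cong (tri p)
                                                                    (≡.trans (executions-run σ ls) (ℕ.+-identityʳ n)))) ⟩
    tri p n + delay s                                          ∎
    where
    s : Schedule
    s = run σ ls
    ·-zeroʳ : ∀ m → m · 0# ≈ 0#
    ·-zeroʳ zero    = refl
    ·-zeroʳ (suc m) = trans (+-identityˡ _) (·-zeroʳ m)

  -- The adaptive model: the game tree and its optimal postponing strategy.

  module Adaptive (n₀ : ℕ) where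
    n : ℕ
    n = suc n₀

    open GameTree n

    ratio′-mono : ∀ c d {e e′} f → e ≤ e′ → ratio′ c d e f ≤ ratio′ c d e′ f
    ratio′-mono c d zero    e≤e′ = /-monoˡ-≤ (0<OPT n₀ (n ∸ c)) (+-monoˡ-≤ _ (+-monoʳ-≤ _ e≤e′))
    ratio′-mono c d (suc f) e≤e′ = ⊓-mono-≤
      (⊔-mono-≤ (ratio′-mono (suc c) d f (+-monoˡ-≤ _ e≤e′)) (ratio′-mono c (suc d) f (+-monoˡ-≤ _ e≤e′)))
      (⊔-mono-≤ (ratio′-mono (suc c) d f e≤e′) (ratio′-mono c d f (+-monoˡ-≤ _ e≤e′)))

    -- With no untested job left the pending jobs are executed anyway, the first of them with rank
    -- `suc d`.
    leafRatio-pending : ∀ c d e → leafRatio c (suc d) e ≈ leafRatio c d (e + suc d · x)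
    leafRatio-pending c d e = *-congʳ (begin-equality
      tri p n + e + tri x (suc d)              ≈⟨ +-congˡ (tri-suc x d) ⟩
      tri p n + e + (suc d · x + tri x d)      ≈⟨ solve 4 (λ a b c d → ((a ⊕ b) ⊕ (c ⊕ d)) ⊜ ((a ⊕ (b ⊕ c)) ⊕ d)) refl
                                                    (tri p n) e (suc d · x) (tri x d) ⟩
      tri p n + (e + suc d · x) + tri x d      ∎)
      where open +-Solver

    -- Under either option for the next job the adversary may answer short, and `e` does not
    -- decrease.
    reveal-short : ∀ c d e f → ratio′ (suc c) d e f ≤ ratio′ c d e (suc f)
    reveal-short c d e f = ⊓-glb
      (≤-trans (ratio′-mono (suc c) d f (x≤x+y (·-nonneg (suc f ℕ.+ d) 0≤1))) (x≤x⊔y _ _))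
      (x≤x⊔y _ _)

    -- Simulation: the algorithm pretends that one pending long job is the
    -- last untested job, whose length the adversary has fixed in advance.
    reveal-long : ∀ c d e f → ratio′ c (suc d) e f ≤ ratio′ c d e (suc f)
    reveal-long c d e zero = ⊓-glb
      (≤-trans (ratio′-mono c (suc d) 0 (x≤x+y (·-nonneg (1 ℕ.+ d) 0≤1))) (x≤y⊔x _ _))
      (≤-trans (≤-reflexive (leafRatio-pending c d e)) (x≤y⊔x _ _))
    reveal-long c d e (suc f) = ⊓-mono-≤
      (⊔-mono-≤
        (≤-trans (ratio′-mono (suc c) (suc d) f (rank 1#)) (reveal-long (suc c) d _ f))
        (≤-trans (ratio′-mono c (suc (suc d)) f (rank 1#)) (reveal-long c (suc d) _ f)))
      (⊔-mono-≤
        (reveal-long (suc c) d e f)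
        (≤-trans (ratio′-mono c (suc d) f (rank x)) (reveal-long c d _ f)))
      where
      -- Trading an untested job for a pending one keeps their sum, so the next action has the same
      -- rank in both games.
      rank : ∀ a → e + (suc f ℕ.+ suc d) · a ≤ e + (suc (suc f) ℕ.+ d) · a
      rank a = ≤-reflexive (+-congˡ (·-congˡ (≡.cong suc (ℕ.+-suc f d))))

    -- Induction on `f`; the reply on the left is to execute the next job untested. If it is long,
    -- `e` grows exactly as by executing the pending job, and `reveal-long` applies. If it is short,
    -- the pending job is executed later with smaller rank, and `reveal-short` applies.
    postpone-pending : ∀ c d e f → ratio′ c (suc d) e f ≤ ratio′ c d (e + (f ℕ.+ suc d) · x) f
    postpone-pending c d e zero    = ≤-reflexive (leafRatio-pending c d e)
    postpone-pending c d e (suc f) = ≤-trans (x⊓y≤y _ _) (⊔-lub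
      (≤-trans (postpone-pending (suc c) d e f)
        (≤-trans (ratio′-mono (suc c) d f (+-monoʳ-≤ e (·-monoˡ-≤ 0≤x (ℕ.n≤1+n (f ℕ.+ suc d)))))
          (reveal-short c d _ f)))
      (reveal-long c d _ f))

    ratio≈ratio′ : ∀ c d e f → ratio c d e f ≈ ratio′ c d e f
    ratio≈ratio′ c d e zero = refl
    ratio≈ratio′ c zero e (suc f) = ⊓-cong
      (⊔-cong (ratio≈ratio′ (suc c) 0 _ f) (ratio≈ratio′ c 1 _ f))
      (⊔-cong (ratio≈ratio′ (suc c) 0 _ f) (ratio≈ratio′ c 0 _ f))
    ratio≈ratio′ c (suc d) e (suc f) = trans
      (⊓-cong
        (⊓-cong
          (⊔-cong (ratio≈ratio′ (suc c) (suc d) _ f) (ratio≈ratio′ c (suc (suc d)) _ f))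
          (⊔-cong (ratio≈ratio′ (suc c) (suc d) _ f) (ratio≈ratio′ c (suc d) _ f)))
        (ratio≈ratio′ c d _ (suc f)))
      (x≤y⇒x⊓y≈x (postpone-pending c d e (suc f)))

    -- The final ratio if `e` has been accumulated and `ℓ` long jobs executed before the remaining
    -- schedule `s`.
    ratioAfter : Carrier → ℕ → Schedule → Carrier
    ratioAfter e ℓ s = (tri p n + (e + delay s)) / OPT n (ℓ ℕ.+ longJobs s)

    ratioAfter-[] : ∀ c ℓ e → ℓ ℕ.+ c ≡ n → ratioAfter e ℓ [] ≈ leafRatio c 0 e
    ratioAfter-[] c ℓ e ℓ+c≡n = *-cong
      (begin-equality
        tri p n + (e + 0#)       ≈⟨ +-assoc _ _ _ ⟨
        tri p n + e + 0#         ≈⟨ +-congˡ (tri≈triangle x 0) ⟨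
        tri p n + e + tri x 0    ∎)
      (⁻¹-cong (reflexive (≡.cong (OPT n) (≡.trans (ℕ.+-identityʳ ℓ)
        (≡.sym (≡.trans (≡.cong (_∸ c) (≡.sym ℓ+c≡n)) (ℕ.m+n∸n≡m ℓ c)))))))

    ratioAfter-test : ∀ e ℓ {N} s → executions s ≡ N →
                      ratioAfter e ℓ (test ∷ s) ≈ ratioAfter (e + N · 1#) ℓ s
    ratioAfter-test e ℓ s ≡.refl = *-congʳ (+-congˡ (sym (+-assoc _ _ _)))

    ratioAfter-long : ∀ e ℓ {N} s → suc (executions s) ≡ N →
                      ratioAfter e ℓ (execute long ∷ s) ≈ ratioAfter (e + N · x) (suc ℓ) s
    ratioAfter-long e ℓ s ≡.refl = *-cong (+-congˡ (sym (+-assoc _ _ _)))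
      (⁻¹-cong (reflexive (≡.cong (OPT n) (ℕ.+-suc ℓ (longJobs s)))))

    -- Pending short jobs only raise the ranks of later actions, so they are counted as gone;
    -- executing a pending long job is covered by `postpone-pending`. The objective `v` absorbs the
    -- prefix of the schedule.
    worst-lower : ∀ {ps} (σ : Strategy ps f) v c e ℓ → ℓ ℕ.+ longs ps ℕ.+ f ℕ.+ c ≡ n →
      (∀ ls → ratioAfter e ℓ (run σ ls) ≤ v (run σ ls)) → ratio′ c (longs ps) e f ≤ worst σ v
    worst-lower done v c e ℓ eq h = ≤-trans (≤-reflexive (sym (ratioAfter-[] c ℓ e
      (≡.trans (≡.cong (ℕ._+ c) (≡.sym (≡.trans (ℕ.+-identityʳ _) (ℕ.+-identityʳ ℓ)))) eq)))) (h [])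
    worst-lower {suc f} {ps} (test k) v c e ℓ eq h = ≤-trans (x⊓y≤x _ _) (⊔-mono-≤
      (≤-trans (ratio′-mono (suc c) (longs ps) f rank)
        (worst-lower (k short) _ (suc c) e′ ℓ (≡.trans (total-short ℓ (longs ps) f c) eq) (h′ short)))
      (≤-trans (ratio′-mono c (suc (longs ps)) f rank)
        (worst-lower (k long) _ c e′ ℓ (≡.trans (total-testLong ℓ (longs ps) f c) eq) (h′ long))))
      where
      e′ : Carrier
      e′ = e + (suc f ℕ.+ length ps) · 1#
      rank : e + (suc f ℕ.+ longs ps) · 1# ≤ e′
      rank = +-monoʳ-≤ e (·-monoˡ-≤ 0≤1 (ℕ.+-monoʳ-≤ (suc f) (longs≤length ps)))
      h′ : ∀ l ls → ratioAfter e′ ℓ (run (k l) ls) ≤ v (test ∷ run (k l) ls)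
      h′ l ls = ≤-trans (≤-reflexive (sym (ratioAfter-test e ℓ (run (k l) ls)
        (≡.trans (executions-run (k l) ls) (ℕ.+-suc f (length ps)))))) (h (l ∷ ls))
    worst-lower {suc f} {ps} (untested k) v c e ℓ eq h = ≤-trans (x⊓y≤y _ _) (⊔-mono-≤
      (worst-lower (k short) _ (suc c) e ℓ (≡.trans (total-short ℓ (longs ps) f c) eq) (λ ls → h (short ∷ ls)))
      (≤-trans (ratio′-mono c (longs ps) f (+-monoʳ-≤ e (·-monoˡ-≤ 0≤x (ℕ.+-monoʳ-≤ (suc f) (longs≤length ps)))))
        (worst-lower (k long) _ c _ (suc ℓ) (≡.trans (total-untestedLong ℓ (longs ps) f c) eq) λ ls →
          ≤-trans (≤-reflexive (sym (ratioAfter-long e ℓ (run (k long) ls) (≡.cong suc (executions-run (k long) ls)))))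
            (h (long ∷ ls)))))
    worst-lower {f} (execute {ps = ps} i σ) v c e ℓ eq h
      with lookup ps i | longs ps | longs-removeAt ps i | longs≤length ps
    ... | short | _ | ≡.refl | _ = worst-lower σ _ c e ℓ eq h
    ... | long  | _ | ≡.refl | d<length = ≤-trans (postpone-pending c (longs (removeAt ps i)) e f)
      (≤-trans (ratio′-mono c (longs (removeAt ps i)) f (+-monoʳ-≤ e (·-monoˡ-≤ 0≤x (ℕ.+-monoʳ-≤ f d<length))))
        (worst-lower σ _ c _ (suc ℓ) (≡.trans (total-executeLong ℓ (longs (removeAt ps i)) f c) eq) λ ls →
          ≤-trans (≤-reflexive (sym (ratioAfter-long e ℓ (run σ ls) (count ls)))) (h ls)))
      where
      count : ∀ ls → suc (executions (run σ ls)) ≡ f ℕ.+ length ps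
      count ls = executions-run (execute {ps = ps} i σ) ls

    bestPolicy : ∀ c d (e : Carrier) f → Policy f
    bestPolicy c d e zero    = done
    bestPolicy c d e (suc f) with total
      (max (ratio′ (suc c) d (e + (suc f ℕ.+ d) · 1#) f) (ratio′ c (suc d) (e + (suc f ℕ.+ d) · 1#) f))
      (max (ratio′ (suc c) d e f) (ratio′ c d (e + (suc f ℕ.+ d) · x) f))
    ... | inj₁ _ = decide test λ where
      short → bestPolicy (suc c) d (e + (suc f ℕ.+ d) · 1#) f
      long  → bestPolicy c (suc d) (e + (suc f ℕ.+ d) · 1#) f
    ... | inj₂ _ = decide untested λ where
      short → bestPolicy (suc c) d e f
      long  → bestPolicy c d (e + (suc f ℕ.+ d) · x) f

    worst-upper : ∀ f d v c e ℓ → ℓ ℕ.+ d ℕ.+ f ℕ.+ c ≡ n →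
      (∀ ls → v (run (postpone d (bestPolicy c d e f)) ls) ≤ ratioAfter e ℓ (run (postpone d (bestPolicy c d e f)) ls)) →
      worst (postpone d (bestPolicy c d e f)) v ≤ ratio′ c d e f
    worst-upper zero zero v c e ℓ eq h = ≤-trans (h []) (≤-reflexive (ratioAfter-[] c ℓ e
      (≡.trans (≡.cong (ℕ._+ c) (≡.sym (≡.trans (ℕ.+-identityʳ _) (ℕ.+-identityʳ ℓ)))) eq)))
    worst-upper zero (suc d) v c e ℓ eq h = ≤-trans
      (worst-upper zero d _ c (e + suc d · x) (suc ℓ) (≡.trans (total-executeLong ℓ d 0 c) eq) λ ls →
        ≤-trans (h ls) (≤-reflexive (ratioAfter-long e ℓ (run (postpone d done) ls)
          (≡.cong suc (executions-postpone d done ls)))))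
      (≤-reflexive (sym (leafRatio-pending c d e)))
    -- Since `min` is itself computed by `total`, this one split reduces both `bestPolicy` and
    -- `ratio′`.
    worst-upper (suc f) d v c e ℓ eq h with total
      (max (ratio′ (suc c) d (e + (suc f ℕ.+ d) · 1#) f) (ratio′ c (suc d) (e + (suc f ℕ.+ d) · 1#) f))
      (max (ratio′ (suc c) d e f) (ratio′ c d (e + (suc f ℕ.+ d) · x) f))
    ... | inj₁ test≤untested = ⊔-mono-≤
      (worst-upper f d _ (suc c) _ ℓ (≡.trans (total-short ℓ d f c) eq) λ ls →
        ≤-trans (h (short ∷ ls)) (≤-reflexive (ratioAfter-test e ℓ
          (execute short ∷ run (postpone d (bestPolicy (suc c) d (e + (suc f ℕ.+ d) · 1#) f)) ls)
          (≡.cong suc (executions-postpone d (bestPolicy (suc c) d (e + (suc f ℕ.+ d) · 1#) f) ls)))))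
      (worst-upper f (suc d) _ c _ ℓ (≡.trans (total-testLong ℓ d f c) eq) λ ls →
        ≤-trans (h (long ∷ ls)) (≤-reflexive (ratioAfter-test e ℓ
          (run (postpone (suc d) (bestPolicy c (suc d) (e + (suc f ℕ.+ d) · 1#) f)) ls)
          (≡.trans (executions-postpone (suc d) (bestPolicy c (suc d) (e + (suc f ℕ.+ d) · 1#) f) ls) (ℕ.+-suc f d)))))
    ... | inj₂ untested≤test = ⊔-mono-≤
      (worst-upper f d _ (suc c) e ℓ (≡.trans (total-short ℓ d f c) eq) λ ls → h (short ∷ ls))
      (worst-upper f d _ c _ (suc ℓ) (≡.trans (total-untestedLong ℓ d f c) eq) λ ls →
        ≤-trans (h (long ∷ ls)) (≤-reflexive (ratioAfter-long e ℓ
          (run (postpone d (bestPolicy c d (e + (suc f ℕ.+ d) · x) f)) ls)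
          (≡.cong suc (executions-postpone d (bestPolicy c d (e + (suc f ℕ.+ d) · x) f) ls)))))

    scheduleRatio≈ : ∀ (σ : Algorithm n) ls → scheduleRatio n (run σ ls) ≈ ratioAfter 0# 0 (run σ ls)
    scheduleRatio≈ σ ls = *-congʳ (trans (cost-run σ ls) (+-congˡ (sym (+-identityˡ _))))

    adaptive-optimal : AdaptiveOptimal (postpone 0 (bestPolicy 0 0 0# n))
    adaptive-optimal τ = ≤-trans
      (worst-upper n 0 _ 0 0# 0 (ℕ.+-identityʳ n) λ ls → ≤-reflexive (scheduleRatio≈ (postpone 0 (bestPolicy 0 0 0# n)) ls))
      (worst-lower τ _ 0 0# 0 (ℕ.+-identityʳ n) λ ls → ≤-reflexive (sym (scheduleRatio≈ τ ls)))

-- Delay counts and bounded search for the non-adaptive model.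

-- With a tests followed by b untested executions, testDelay counts the jobs
-- delayed by each test if no long job is pending; pendingDelay t k counts the
-- further delays of k long jobs, tested before t short ones and kept to the end.
testDelay : ℕ → ℕ → ℕ
testDelay zero    b = 0
testDelay (suc a) b = suc a ℕ.+ b ℕ.+ testDelay a b

pendingDelay : ℕ → ℕ → ℕ
pendingDelay t zero    = 0
pendingDelay t (suc k) = t ℕ.+ k ℕ.+ pendingDelay t k

-- The definition peels off the first test. Here the last one, of rank `suc b`, is peeled off and
-- its job joins the untested phase.
testDelay-suc : ∀ a b → testDelay (suc a) b ≡ suc b ℕ.+ testDelay a (suc b)
testDelay-suc zero    b = ≡.refl
testDelay-suc (suc a) b = ≡.trans (≡.cong (suc (suc a) ℕ.+ b ℕ.+_) (testDelay-suc a b))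
  (eq a b (testDelay a (suc b)))
  where
  eq : ∀ a b c → suc (suc a) ℕ.+ b ℕ.+ (suc b ℕ.+ c) ≡ suc b ℕ.+ (suc a ℕ.+ suc b ℕ.+ c)
  eq = solve-∀

-- Minimality of the counterexample is recorded as validity at its immediate predecessor, the form
-- used by `first-gain`.
least-counterexample : ∀ {ℓ} {P : ℕ → Set ℓ} → (∀ m → Dec (P m)) → ∀ N →
  (∀ m → m ℕ.≤ N → P m) ⊎
  (∃[ m ] m ℕ.≤ N × ¬ P m × (∀ j → m ≡ suc j → P j))
least-counterexample {P = P} P? zero with P? 0
... | yes p = inj₁ λ { zero z≤n → p }
... | no ¬p = inj₂ (0 , z≤n , ¬p , λ _ ())
least-counterexample {P = P} P? (suc N) with least-counterexample P? N
... | inj₂ (m , m≤N , rest) = inj₂ (m , ℕ.m≤n⇒m≤1+n m≤N , rest)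
... | inj₁ below with P? (suc N)
...   | no ¬p = inj₂ (suc N , ℕ.≤-refl , ¬p , λ { j ≡.refl → below j ℕ.≤-refl })
...   | yes p = inj₁ λ m m≤ → [ (λ m<1+N → below m (ℕ.s≤s⁻¹ m<1+N)) , (λ { ≡.refl → p }) ]′ (ℕ.m≤n⇒m<n∨m≡n m≤)

+-trade : ∀ {i j i′ j′} → i ℕ.+ j ≡ i′ ℕ.+ j′ → j′ ℕ.< j → i ℕ.< i′
+-trade {i} {j} {i′} {j′} eq j′<j = ℕ.+-cancelʳ-≤ j′ (suc i) i′ (begin
  suc i ℕ.+ j′  ≡⟨ ℕ.+-suc i j′ ⟨
  i ℕ.+ suc j′  ≤⟨ ℕ.+-monoʳ-≤ i j′<j ⟩
  i ℕ.+ j       ≡⟨ eq ⟩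
  i′ ℕ.+ j′     ∎)
  where open ℕ.≤-Reasoning

-- The exchange argument: trading one test for an untested execution.

module Excess {c ℓ₁ ℓ₂} (K : OrderedField c ℓ₁ ℓ₂) (x : OrderedField.Carrier K) (u : ℕ) where
  open OrderedField K hiding (zero)
  open OrderedFieldProperties K

  -- A pending long job is delayed by the t + k later tests or, if executed at
  -- once, delays the z short jobs by x each.  We take u = 1 if x ≥ 1 and u = 0
  -- if x ≤ 1, when tests do not pay and the weaker bound suffices.
  earlyDelay : ℕ → ℕ → ℕ → Carrier
  earlyDelay t zero    z = 0#
  earlyDelay t (suc k) z = min (((t ℕ.+ k) ℕ.* u) · 1#) (z · x) + earlyDelay t k z

  -- Delay beyond `tri x (k + m)`: the tests, the pending long jobs, and the `m` untested long jobs
  -- that each precede `s` short ones.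
  lowerExcess upperExcess : (k t m s : ℕ) → Carrier
  lowerExcess k t m s =
    testDelay (k ℕ.+ t) (m ℕ.+ s) · 1# + earlyDelay t k (t ℕ.+ s) + (m ℕ.* s) · x
  upperExcess k t m s =
    (testDelay (k ℕ.+ t) (m ℕ.+ s) ℕ.+ pendingDelay t k) · 1# + (m ℕ.* s) · x

  -- The bound `D` enters through its convexity, that is, its nondecreasing increments `δ`. It is
  -- later instantiated with `slack r`.
  module Exchange (0≤x : 0# ≤ x) (x≤1⊎u≡1 : x ≤ 1# ⊎ u ≡ 1)
    (D δ : ℕ → Carrier) (D-suc : ∀ ℓ → D (suc ℓ) ≈ D ℓ + δ ℓ)
    (δ-mono : ∀ {i j} → i ℕ.≤ j → δ i ≤ δ j)
    where
    -- D ℓ is the delay over OPT allowed by the ratio r when ℓ jobs are long.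
    -- There are a + 1 tests, and the last tested job is short: if it were
    -- long, D would grow but the excess would not.
    Lower Upper : ℕ → ℕ → Set ℓ₂
    Lower a b = ∀ k t m s → k ℕ.+ t ≡ a → m ℕ.+ s ≡ b → lowerExcess k (suc t) m s ≤ D (k ℕ.+ m)
    Upper a b = ∀ k t m s → k ℕ.+ t ≡ a → m ℕ.+ s ≡ b → upperExcess k (suc t) m s ≤ D (k ℕ.+ m)

    earlyDelay-mono-t : ∀ t k z → earlyDelay t k z ≤ earlyDelay (suc t) k z
    earlyDelay-mono-t t zero    z = ≤-refl
    earlyDelay-mono-t t (suc k) z = +-mono-≤
      (⊓-mono-≤ (·-monoˡ-≤ 0≤1 (ℕ.*-monoˡ-≤ u (ℕ.n≤1+n (t ℕ.+ k)))) ≤-refl) (earlyDelay-mono-t t k z)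

    -- At `z′` keeping is no dearer than executing at once for each of the `k` jobs, so every
    -- minimum there is attained by its first argument, which also bounds the minimum at `z`.
    earlyDelay-bound : ∀ t k {z z′} → ((t ℕ.+ k) ℕ.* u) · 1# ≤ z′ · x →
                       earlyDelay t k z ≤ earlyDelay t k z′
    earlyDelay-bound t zero    h = ≤-refl
    earlyDelay-bound t (suc k) {z} {z′} h = +-mono-≤
      (⊓-glb (x⊓y≤x _ _) (≤-trans (x⊓y≤x _ _) h′))
      (earlyDelay-bound t k h′)
      where
      h′ : ((t ℕ.+ k) ℕ.* u) · 1# ≤ z′ · x
      h′ = ≤-trans (·-monoˡ-≤ 0≤1 (ℕ.*-monoˡ-≤ u (ℕ.+-monoʳ-≤ t (ℕ.n≤1+n k)))) h

    -- The first tested job has the largest delay `t + k`. If keeping is no dearer for it, the same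
    -- holds for the others.
    pendingDelay≤earlyDelay : u ≡ 1 → ∀ t k {z} → (t ℕ.+ k) · 1# ≤ z · x →
                              pendingDelay t (suc k) · 1# ≤ earlyDelay t (suc k) z
    pendingDelay≤earlyDelay ≡.refl t k {z} h = begin
      pendingDelay t (suc k) · 1#                ≈⟨ ·-homo-+ 1# (t ℕ.+ k) (pendingDelay t k) ⟩
      (t ℕ.+ k) · 1# + pendingDelay t k · 1#     ≤⟨ +-mono-≤
                                                      (⊓-glb (≤-reflexive (·-congˡ {1#} (≡.sym (ℕ.*-identityʳ (t ℕ.+ k))))) h)
                                                      (rest k h) ⟩
      earlyDelay t (suc k) z                     ∎
      where
      rest : ∀ k → (t ℕ.+ k) · 1# ≤ z · x → pendingDelay t k · 1# ≤ earlyDelay t k z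
      rest zero    h = ≤-refl
      rest (suc k) h = pendingDelay≤earlyDelay ≡.refl t k
        (≤-trans (·-monoˡ-≤ 0≤1 (ℕ.+-monoʳ-≤ t (ℕ.n≤1+n k))) h)

    Violation : ℕ → ℕ → Set ℓ₂
    Violation a b = ∃[ k ] ∃[ t ] ∃[ m ] ∃[ s ] k ℕ.+ t ≡ a × m ℕ.+ s ≡ b ×
      ¬ (upperExcess k (suc t) m s ≤ D (k ℕ.+ m)) ×
      (∀ j → m ≡ suc j → upperExcess k (suc t) j (suc s) ≤ D (k ℕ.+ j))

    upper? : ∀ a b → Upper a b ⊎ Violation a b
    upper? a b with least-counterexample row? a
      where
      P : ℕ → ℕ → Set ℓ₂
      P k m = upperExcess k (suc (a ℕ.∸ k)) m (b ℕ.∸ m) ≤ D (k ℕ.+ m)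
      row? : ∀ k → Dec (∀ m → m ℕ.≤ b → P k m)
      row? k with least-counterexample {P = P k} (λ m → _ ≤? _) b
      ... | inj₁ all = yes all
      ... | inj₂ (m , m≤b , ¬p , _) = no λ all → ¬p (all m m≤b)
    ... | inj₁ all = inj₁ λ { k t m s ≡.refl ≡.refl →
      ≡.subst₂ (λ t s′ → upperExcess k (suc t) m s′ ≤ D (k ℕ.+ m)) (ℕ.m+n∸m≡n k t) (ℕ.m+n∸m≡n m s)
        (all k (ℕ.m≤m+n k t) m (ℕ.m≤m+n m s)) }
    ... | inj₂ (k , k≤a , ¬row , _)
      -- The decision `row?` reports only that row `k` fails, so the row is searched again for `m`.
      with least-counterexample {P = λ m → upperExcess k (suc (a ℕ.∸ k)) m (b ℕ.∸ m) ≤ D (k ℕ.+ m)} (λ m → _ ≤? _) b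
    ...   | inj₁ row = contradiction row ¬row
    ...   | inj₂ (m , m≤b , ¬p , first) = inj₂
      (k , a ℕ.∸ k , m , b ℕ.∸ m , ℕ.m+[n∸m]≡n k≤a , ℕ.m+[n∸m]≡n m≤b , ¬p , λ { j ≡.refl →
        ≡.subst (λ s → upperExcess k (suc (a ℕ.∸ k)) j s ≤ D (k ℕ.+ j)) (ℕ.+-∸-assoc 1 m≤b) (first j ≡.refl) })

    -- Passage from `suc (suc a)` tests and `b` untested executions to `suc a` and `suc b`. The
    -- starred parameters are those of a violation of `Upper (suc a) b`.
    module Step {a b : ℕ} (lower : Lower (suc a) b)
      (k* t* m* s* : ℕ) (k*+t*≡1+a : k* ℕ.+ t* ≡ suc a) (m*+s*≡b : m* ℕ.+ s* ≡ b)
      (violated : ¬ (upperExcess k* (suc t*) m* s* ≤ D (k* ℕ.+ m*)))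
      (first : ∀ j → m* ≡ suc j → upperExcess k* (suc t*) j (suc s*) ≤ D (k* ℕ.+ j))
      where

      -- Otherwise keeping would be no dearer for all `k*` pending jobs, the first of which has
      -- delay `suc a`. Then `lowerExcess` would reach `upperExcess`, and `lower` would contradict
      -- `violated`.
      few-shorts : u ≡ 1 → ¬ (suc a · 1# ≤ (suc t* ℕ.+ s*) · x)
      few-shorts u≡1 1+a≤z*x = violated (begin
        (testDelay (k* ℕ.+ suc t*) (m* ℕ.+ s*) ℕ.+ pendingDelay (suc t*) k*) · 1# + (m* ℕ.* s*) · x
          ≈⟨ +-congʳ (·-homo-+ 1# (testDelay (k* ℕ.+ suc t*) (m* ℕ.+ s*)) _) ⟩
        testDelay (k* ℕ.+ suc t*) (m* ℕ.+ s*) · 1# + pendingDelay (suc t*) k* · 1# + (m* ℕ.* s*) · x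
          ≤⟨ +-monoˡ-≤ _ (+-monoʳ-≤ _ (early k* k*+t*≡1+a)) ⟩
        lowerExcess k* (suc t*) m* s*
          ≤⟨ lower k* t* m* s* k*+t*≡1+a m*+s*≡b ⟩
        D (k* ℕ.+ m*) ∎)
        where
        early : ∀ k → k ℕ.+ t* ≡ suc a → pendingDelay (suc t*) k · 1# ≤ earlyDelay (suc t*) k (suc t* ℕ.+ s*)
        early zero    _  = ≤-refl
        early (suc k) eq = pendingDelay≤earlyDelay u≡1 (suc t*) k
          (≤-trans (≤-reflexive (·-congˡ (≡.cong suc (≡.trans (ℕ.+-comm t* k) (ℕ.suc-injective eq))))) 1+a≤z*x)

      -- From `j` to `suc j` untested long jobs the excess changes by `(s* - j) · x` and `D` by
      -- `δ (k* + j)`. As the excess passes from within `D` to beyond it, it grows at least as much.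
      first-gain : ∀ j → m* ≡ suc j → δ (k* ℕ.+ j) + j · x ≤ s* · x
      first-gain j ≡.refl = +-cancelˡ-≤ (A · 1# + (j ℕ.* suc s*) · x) (begin
        A · 1# + (j ℕ.* suc s*) · x + (δ (k* ℕ.+ j) + j · x)
          ≤⟨ +-monoˡ-≤ _ A+js≤D ⟩
        D (k* ℕ.+ j) + (δ (k* ℕ.+ j) + j · x)
          ≈⟨ +-assoc _ _ _ ⟨
        D (k* ℕ.+ j) + δ (k* ℕ.+ j) + j · x
          ≈⟨ +-congʳ (D-suc (k* ℕ.+ j)) ⟨
        D (suc (k* ℕ.+ j)) + j · x
          ≈⟨ +-congʳ (reflexive (≡.cong D (≡.sym (ℕ.+-suc k* j)))) ⟩
        D (k* ℕ.+ suc j) + j · x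
          ≤⟨ +-monoˡ-≤ _ D≤A+ms ⟩
        A · 1# + (suc j ℕ.* s*) · x + j · x
          ≈⟨ +-assoc _ _ _ ⟩
        A · 1# + ((suc j ℕ.* s*) · x + j · x)
          ≈⟨ +-congˡ (·-homo-+ x (suc j ℕ.* s*) j) ⟨
        A · 1# + (suc j ℕ.* s* ℕ.+ j) · x
          ≈⟨ +-congˡ (·-congˡ (eq j s*)) ⟩
        A · 1# + (j ℕ.* suc s* ℕ.+ s*) · x
          ≈⟨ +-congˡ (·-homo-+ x (j ℕ.* suc s*) s*) ⟩
        A · 1# + ((j ℕ.* suc s*) · x + s* · x)
          ≈⟨ +-assoc _ _ _ ⟨
        A · 1# + (j ℕ.* suc s*) · x + s* · x ∎)
        where
        A : ℕ
        A = testDelay (k* ℕ.+ suc t*) (m* ℕ.+ s*) ℕ.+ pendingDelay (suc t*) k*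
        D≤A+ms : D (k* ℕ.+ suc j) ≤ A · 1# + (suc j ℕ.* s*) · x
        D≤A+ms with total (D (k* ℕ.+ suc j)) (A · 1# + (suc j ℕ.* s*) · x)
        ... | inj₁ D≤ = D≤
        ... | inj₂ ≤D = contradiction ≤D violated
        A+js≤D : A · 1# + (j ℕ.* suc s*) · x ≤ D (k* ℕ.+ j)
        A+js≤D = ≡.subst (λ b →
          (testDelay (k* ℕ.+ suc t*) b ℕ.+ pendingDelay (suc t*) k*) · 1# + (j ℕ.* suc s*) · x ≤ D (k* ℕ.+ j))
          (ℕ.+-suc j s*) (first j ≡.refl)
        eq : ∀ j s → suc j ℕ.* s ℕ.+ j ≡ j ℕ.* suc s ℕ.+ s
        eq = solve-∀

      -- By `few-shorts` the violation has `t* + s* < s`. Hence `m < m*`, and as `k + m + t + s` and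
      -- `k* + j + t* + s*` both equal `a + b`, also `k + m ≤ k* + j`. Monotonicity of `δ` then
      -- transfers `first-gain` to the present parameters.
      more-longs : ∀ k t m s → k ℕ.+ t ≡ a → m ℕ.+ suc s ≡ suc b → u ≡ 1 →
                   (suc b ℕ.+ (suc t ℕ.+ k)) · 1# ≤ suc s · x →
                   δ (k ℕ.+ m) + m · x ≤ s · x
      more-longs k t m s k+t≡a m+1+s≡1+b u≡1 n≤sx = go m* ≡.refl
        where
        z*<1+s : suc (suc t* ℕ.+ s*) ℕ.≤ suc s
        z*<1+s = ℕ.≰⇒> λ 1+s≤z* → few-shorts u≡1 (begin
          suc a · 1#                          ≤⟨ ·-monoˡ-≤ 0≤1 (ℕ.≤-trans
                                                   (ℕ.≤-reflexive (≡.cong suc (≡.trans (≡.sym k+t≡a) (ℕ.+-comm k t))))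
                                                   (ℕ.m≤n+m (suc t ℕ.+ k) (suc b))) ⟩
          (suc b ℕ.+ (suc t ℕ.+ k)) · 1#      ≤⟨ n≤sx ⟩
          suc s · x                           ≤⟨ ·-monoˡ-≤ 0≤x 1+s≤z* ⟩
          (suc t* ℕ.+ s*) · x                 ∎)
        t*+s*<s : suc (t* ℕ.+ s*) ℕ.≤ s
        t*+s*<s = ℕ.s≤s⁻¹ z*<1+s
        m+s≡m*+s* : m ℕ.+ s ≡ m* ℕ.+ s*
        m+s≡m*+s* = ≡.trans (ℕ.suc-injective (≡.trans (≡.sym (ℕ.+-suc m s)) m+1+s≡1+b)) (≡.sym m*+s*≡b)
        m<m* : suc m ℕ.≤ m*
        m<m* = +-trade m+s≡m*+s* (ℕ.≤-trans (s≤s (ℕ.m≤n+m s* t*)) t*+s*<s)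
        go : ∀ j → m* ≡ j → δ (k ℕ.+ m) + m · x ≤ s · x
        go zero    m*≡0 = contradiction (≡.subst (suc m ℕ.≤_) m*≡0 m<m*) λ ()
        go (suc j) m*≡1+j = begin
          δ (k ℕ.+ m) + m · x    ≤⟨ +-mono-≤ (δ-mono k+m≤k*+j) (·-monoˡ-≤ 0≤x m≤j) ⟩
          δ (k* ℕ.+ j) + j · x   ≤⟨ first-gain j m*≡1+j ⟩
          s* · x                 ≤⟨ ·-monoˡ-≤ 0≤x (ℕ.≤-trans (ℕ.m≤n+m s* (suc t*)) t*+s*<s) ⟩
          s · x                  ∎
          where
          m≤j : m ℕ.≤ j
          m≤j = ℕ.s≤s⁻¹ (≡.subst (suc m ℕ.≤_) m*≡1+j m<m*)
          k+m≤k*+j : k ℕ.+ m ℕ.≤ k* ℕ.+ j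
          k+m≤k*+j = ℕ.<⇒≤ (+-trade total≡ (ℕ.m≤n⇒m≤o+n t t*+s*<s))
            where
            total≡ : k ℕ.+ m ℕ.+ (t ℕ.+ s) ≡ k* ℕ.+ j ℕ.+ (t* ℕ.+ s*)
            total≡ = ≡.trans (+-interchange k m t s) (≡.trans
              (≡.cong₂ ℕ._+_ k+t≡a (≡.trans m+s≡m*+s* (≡.cong (ℕ._+ s*) m*≡1+j))) (≡.trans
              (ℕ.+-suc a (j ℕ.+ s*)) (≡.trans
              (≡.cong (ℕ._+ (j ℕ.+ s*)) (≡.sym k*+t*≡1+a))
              (+-interchange k* t* j s*))))

      level : ∀ {k t m s} → k ℕ.+ t ≡ a → m ℕ.+ s ≡ suc b →
              testDelay (k ℕ.+ suc t) (m ℕ.+ s) ≡ testDelay (suc a) (suc b)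
      level {k} {t} k+t≡a m+s≡1+b = ≡.cong₂ testDelay (≡.trans (ℕ.+-suc k t) (≡.cong suc k+t≡a)) m+s≡1+b

      T′ : Carrier
      T′ = testDelay (suc a) (suc b) · 1#

      T : Carrier
      T = testDelay (suc (suc a)) b · 1#

      T≈ : T ≈ suc b · 1# + T′
      T≈ = trans (·-congˡ (testDelay-suc (suc a) b)) (·-homo-+ 1# (suc b) _)

      T′≤T : T′ ≤ T
      T′≤T = ≤-trans (x≤y+x (·-nonneg (suc b) 0≤1)) (≤-reflexive (sym T≈))

      -- Comparison with one more test, in which an untested long job is tested.
      untested⇒tested : ∀ s k t m → k ℕ.+ t ≡ a → suc m ℕ.+ s ≡ suc b →
        s · x ≤ (suc b ℕ.+ (suc t ℕ.+ k) ℕ.* u) · 1# →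
        lowerExcess k (suc t) (suc m) s ≤ D (k ℕ.+ suc m)
      untested⇒tested s k t m k+t≡a m+s≡b sx≤ = begin
        testDelay (k ℕ.+ suc t) (suc m ℕ.+ s) · 1# + M + (s ℕ.+ m ℕ.* s) · x
          ≈⟨ +-cong (+-congʳ (·-congˡ (level {k} {t} {suc m} {s} k+t≡a m+s≡b))) (·-homo-+ x s (m ℕ.* s)) ⟩
        T′ + M + (s · x + (m ℕ.* s) · x)
          -- The cost `s · x` of an untested long job is exchanged for the rank `suc b` of a further
          -- test and the price `w` of a further pending job. Keeping that job is covered by `sx≤`;
          -- executing it at once costs at least `s · x`.
          ≤⟨ +-monoʳ-≤ _ (+-monoˡ-≤ _ (≤-+-⊓
               (≤-trans sx≤ (≤-reflexive (·-homo-+ 1# (suc b) _)))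
               (≤-trans (·-monoˡ-≤ 0≤x (ℕ.m≤n+m s (suc t))) (x≤y+x (·-nonneg (suc b) 0≤1))))) ⟩
        T′ + M + (suc b · 1# + w + (m ℕ.* s) · x)
          ≈⟨ solve 5 (λ T M B w X → ((T ⊕ M) ⊕ ((B ⊕ w) ⊕ X)) ⊜ (((B ⊕ T) ⊕ (w ⊕ M)) ⊕ X)) refl
               T′ M (suc b · 1#) w ((m ℕ.* s) · x) ⟩
        suc b · 1# + T′ + (w + M) + (m ℕ.* s) · x
          ≈⟨ +-congʳ (+-congʳ T≈) ⟨
        T + (w + M) + (m ℕ.* s) · x
          ≈⟨ +-congʳ (+-congʳ (·-congˡ (≡.cong₂ testDelay 2+a≡ (≡.sym (ℕ.suc-injective m+s≡b))))) ⟩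
        lowerExcess (suc k) (suc t) m s
          ≤⟨ lower (suc k) t m s (≡.cong suc k+t≡a) (ℕ.suc-injective m+s≡b) ⟩
        D (suc k ℕ.+ m)
          ≈⟨ reflexive (≡.cong D (≡.sym (ℕ.+-suc k m))) ⟩
        D (k ℕ.+ suc m) ∎
        where
        open +-Solver
        M w : Carrier
        M = earlyDelay (suc t) k (suc t ℕ.+ s)
        w = min (((suc t ℕ.+ k) ℕ.* u) · 1#) ((suc t ℕ.+ s) · x)
        2+a≡ : suc (suc a) ≡ suc k ℕ.+ suc t
        2+a≡ = ≡.cong suc (≡.trans (≡.cong suc (≡.sym k+t≡a)) (≡.sym (ℕ.+-suc k t)))

      -- If the comparison with one more test fails, making one more untested
      -- job long only increases the excess over D.
      step : ∀ s k t m → k ℕ.+ t ≡ a → m ℕ.+ s ≡ suc b → lowerExcess k (suc t) m s ≤ D (k ℕ.+ m)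
      -- Without untested long jobs the comparison is with one more tested short job, which lowers
      -- neither the test delay nor `earlyDelay`.
      step s k t zero k+t≡a ≡.refl = begin
        testDelay (k ℕ.+ suc t) (suc b) · 1# + earlyDelay (suc t) k (suc t ℕ.+ suc b) + 0#
          ≤⟨ +-monoˡ-≤ 0# (+-mono-≤
               (≤-trans (≤-reflexive (·-congˡ (level {k} {t} {0} {suc b} k+t≡a ≡.refl))) T′≤T)
               (earlyDelay-mono-t (suc t) k _)) ⟩
        T + earlyDelay (suc (suc t)) k (suc t ℕ.+ suc b) + 0#
          ≈⟨ +-congʳ (+-cong (·-congˡ (≡.cong (λ a → testDelay a b) (≡.sym 2+a≡)))
               (reflexive (≡.cong (earlyDelay (suc (suc t)) k) (ℕ.+-suc (suc t) b)))) ⟩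
        lowerExcess k (suc (suc t)) 0 b
          ≤⟨ lower k (suc t) 0 b (≡.trans (ℕ.+-suc k t) (≡.cong suc k+t≡a)) ≡.refl ⟩
        D (k ℕ.+ 0) ∎
        where
        2+a≡ : k ℕ.+ suc (suc t) ≡ suc (suc a)
        2+a≡ = ≡.trans (ℕ.+-suc k (suc t)) (≡.cong suc (≡.trans (ℕ.+-suc k t) (≡.cong suc k+t≡a)))
      step zero k t (suc m) k+t≡a m+s≡b =
        untested⇒tested 0 k t m k+t≡a m+s≡b (·-nonneg (suc b ℕ.+ (suc t ℕ.+ k) ℕ.* u) 0≤1)
      step (suc s′) k t (suc m) k+t≡a m+s≡b with suc s′ · x ≤? (suc b ℕ.+ (suc t ℕ.+ k) ℕ.* u) · 1#
      ... | yes sx≤ = untested⇒tested (suc s′) k t m k+t≡a m+s≡b sx≤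
      -- One more long job turns the product `suc m * suc s′` into `suc (suc m) * s′`. Adding
      -- `s′ · x` to both sides avoids subtraction.
      ... | no sx≰ = +-cancelʳ-≤ (s′ · x) (begin
        A + earlyDelay (suc t) k (suc t ℕ.+ suc s′) + (suc m ℕ.* suc s′) · x + s′ · x
          ≈⟨ +-assoc _ _ _ ⟩
        A + earlyDelay (suc t) k (suc t ℕ.+ suc s′) + ((suc m ℕ.* suc s′) · x + s′ · x)
          ≈⟨ +-cong (+-congʳ (·-congˡ (≡.cong (testDelay (k ℕ.+ suc t)) (ℕ.+-suc (suc m) s′))))
               (trans (sym (·-homo-+ x (suc m ℕ.* suc s′) s′)) (·-congˡ (eq m s′))) ⟩
        A′ + earlyDelay (suc t) k (suc t ℕ.+ suc s′) + (suc (suc m) ℕ.* s′ ℕ.+ suc m) · x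
          ≤⟨ +-mono-≤ (+-monoʳ-≤ _ (earlyDelay-bound (suc t) k early))
               (≤-reflexive (·-homo-+ x (suc (suc m) ℕ.* s′) (suc m))) ⟩
        A′ + earlyDelay (suc t) k (suc t ℕ.+ s′) + ((suc (suc m) ℕ.* s′) · x + suc m · x)
          ≈⟨ +-assoc _ _ _ ⟨
        lowerExcess k (suc t) (suc (suc m)) s′ + suc m · x
          ≤⟨ +-monoˡ-≤ _ (step s′ k t (suc (suc m)) k+t≡a (≡.trans (≡.sym (ℕ.+-suc (suc m) s′)) m+s≡b)) ⟩
        D (k ℕ.+ suc (suc m)) + suc m · x
          ≈⟨ +-congʳ (trans (reflexive (≡.cong D (ℕ.+-suc k (suc m)))) (D-suc (k ℕ.+ suc m))) ⟩
        D (k ℕ.+ suc m) + δ (k ℕ.+ suc m) + suc m · x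
          ≈⟨ +-assoc _ _ _ ⟩
        D (k ℕ.+ suc m) + (δ (k ℕ.+ suc m) + suc m · x)
          ≤⟨ +-monoʳ-≤ _ (more-longs k t (suc m) s′ k+t≡a m+s≡b u≡1 n≤sx) ⟩
        D (k ℕ.+ suc m) + s′ · x ∎)
        where
        A A′ : Carrier
        A = testDelay (k ℕ.+ suc t) (suc m ℕ.+ suc s′) · 1#
        A′ = testDelay (k ℕ.+ suc t) (suc (suc m) ℕ.+ s′) · 1#
        ≤sx : (suc b ℕ.+ (suc t ℕ.+ k) ℕ.* u) · 1# ≤ suc s′ · x
        ≤sx = [ (λ sx≤ → contradiction sx≤ sx≰) , (λ ≤sx → ≤sx) ]′ (total _ _)
        -- For `x ≤ 1` the comparison would have succeeded, because `suc s′ ≤ suc b`.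
        u≡1 : u ≡ 1
        u≡1 = [ (λ x≤1 → contradiction (sx≤s x≤1) sx≰) , (λ u≡1 → u≡1) ]′ x≤1⊎u≡1
          where
          sx≤s : x ≤ 1# → suc s′ · x ≤ (suc b ℕ.+ (suc t ℕ.+ k) ℕ.* u) · 1#
          sx≤s x≤1 = begin
            suc s′ · x                                ≤⟨ ·-monoʳ-≤ (suc s′) x≤1 ⟩
            suc s′ · 1#                               ≤⟨ ·-monoˡ-≤ 0≤1 (ℕ.m+n≤o⇒n≤o (suc m) (ℕ.≤-reflexive m+s≡b)) ⟩
            suc b · 1#                                ≤⟨ ·-monoˡ-≤ 0≤1 (ℕ.m≤m+n (suc b) _) ⟩
            (suc b ℕ.+ (suc t ℕ.+ k) ℕ.* u) · 1#      ∎
        n≤sx : (suc b ℕ.+ (suc t ℕ.+ k)) · 1# ≤ suc s′ · x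
        n≤sx = ≤-trans (≤-reflexive (·-congˡ (≡.cong (suc b ℕ.+_) (≡.sym (≡.trans
           (≡.cong ((suc t ℕ.+ k) ℕ.*_) u≡1) (ℕ.*-identityʳ _)))))) ≤sx
        -- The last tested job is short and makes up for the short job lost: `suc s′ ≤ suc t + s′`.
        early : ((suc t ℕ.+ k) ℕ.* u) · 1# ≤ (suc t ℕ.+ s′) · x
        early = ≤-trans (·-monoˡ-≤ 0≤1 (ℕ.m≤n+m _ (suc b))) (≤-trans ≤sx (·-monoˡ-≤ 0≤x (s≤s (ℕ.m≤n+m s′ t))))
        eq : ∀ m s → suc m ℕ.* suc s ℕ.+ s ≡ suc (suc m) ℕ.* s ℕ.+ suc m
        eq = solve-∀

    -- Descent on `a`: each violation of `Upper` licenses `Step`, which gives up one test.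
    lower⇒upper : ∀ a b → Lower a b → ∃[ a′ ] ∃[ b′ ] a′ ℕ.+ b′ ≡ a ℕ.+ b × Upper a′ b′
    lower⇒upper a b lower with upper? a b
    ... | inj₁ upper = a , b , ≡.refl , upper
    -- The single test reveals a short job, so nothing is pending and both excesses agree.
    lower⇒upper zero b lower | inj₂ (zero , zero , m , s , ≡.refl , m+s≡b , violated , _) =
      contradiction (≤-trans (≤-reflexive (+-congʳ (trans (·-congˡ (ℕ.+-identityʳ (testDelay 1 (m ℕ.+ s)))) (sym (+-identityʳ _)))))
        (lower 0 0 m s ≡.refl m+s≡b)) violated
    lower⇒upper (suc a) b lower | inj₂ (k , t , m , s , k+t≡1+a , m+s≡b , violated , first)
      with lower⇒upper a (suc b) (λ k′ t′ m′ s′ → Step.step lower k t m s k+t≡1+a m+s≡b violated first s′ k′ t′ m′)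
    ... | a′ , b′ , a′+b′≡ , upper = a′ , b′ , ≡.trans a′+b′≡ (ℕ.+-suc a b) , upper

-- Two-phase decision vectors and the adversary revealing long jobs first.

data Phases : ℕ → ℕ → Vec Decision f → Set where
  []         : Phases 0 0 []
  untested∷_ : ∀ {b} {w : Vec Decision f} → Phases 0 b w → Phases 0 (suc b) (untested ∷ w)
  test∷_     : ∀ {a b} {w : Vec Decision f} → Phases a b w → Phases (suc a) b (test ∷ w)

phases : ∀ a b → a ℕ.+ b ≡ f → ∃[ w ] Phases {f = f} a b w
phases zero    zero    ≡.refl = [] , []
phases zero    (suc b) ≡.refl with phases zero b ≡.refl
... | w , ph = untested ∷ w , untested∷ ph
phases (suc a) b       ≡.refl with phases a b ≡.refl
... | w , ph = test ∷ w , test∷ ph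

phases-length : ∀ {a b} {w : Vec Decision f} → Phases a b w → a ℕ.+ b ≡ f
phases-length []            = ≡.refl
phases-length (untested∷ φ) = ≡.cong suc (phases-length φ)
phases-length (test∷ φ)     = ≡.cong suc (phases-length φ)

-- All branches follow the same `w`, so the branch of short replies already determines its shape.
noTest-phases : ∀ {ps w} {σ : Strategy ps f} → NoTest σ → Follows w σ → Phases 0 f w
noTest-phases done         done         = []
noTest-phases (untested h) (untested g) = untested∷ noTest-phases (h short) (g short)
noTest-phases (execute h)  (execute g)  = noTest-phases h g

twoPhase-phases : ∀ {ps w} {σ : Strategy ps f} → TwoPhase σ → Follows w σ →
                  ∃[ a ] ∃[ b ] Phases a b w
twoPhase-phases done         done         = 0 , 0 , []
twoPhase-phases (test h)     (test g)     with twoPhase-phases (h short) (g short)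
... | a , b , φ = suc a , b , test∷ φ
twoPhase-phases (untested h) (untested g) = 0 , _ , untested∷ noTest-phases (h short) (g short)
twoPhase-phases (execute h)  (execute g)  = twoPhase-phases h g

fixed : Vec Decision f → Policy f
fixed []      = done
fixed (δ ∷ w) = decide δ λ _ → fixed w

postpone-follows : ∀ d (w : Vec Decision f) → Follows w (postpone d (fixed w))
postpone-follows zero    []             = done
postpone-follows (suc d) []             = execute (postpone-follows d [])
postpone-follows d       (test ∷ w)     = test λ where
  short → execute (postpone-follows d w)
  long  → postpone-follows (suc d) w
postpone-follows d       (untested ∷ w) = untested λ l → postpone-follows d w

-- Within each of the two phases all long jobs precede all short ones: k long
-- and t short jobs are tested, m long and s short jobs are executed untested.
data LongsFirst : (k t m s : ℕ) → Vec Decision f → Vec Length f → Set where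
  []            : LongsFirst 0 0 0 0 [] []
  untestedShort : ∀ {s} {w : Vec Decision f} {ls} → LongsFirst 0 0 0 s w ls →
                  LongsFirst 0 0 0 (suc s) (untested ∷ w) (short ∷ ls)
  untestedLong  : ∀ {m s} {w : Vec Decision f} {ls} → LongsFirst 0 0 m s w ls →
                  LongsFirst 0 0 (suc m) s (untested ∷ w) (long ∷ ls)
  testShort     : ∀ {t m s} {w : Vec Decision f} {ls} → LongsFirst 0 t m s w ls →
                  LongsFirst 0 (suc t) m s (test ∷ w) (short ∷ ls)
  testLong      : ∀ {k t m s} {w : Vec Decision f} {ls} → LongsFirst k t m s w ls →
                  LongsFirst (suc k) t m s (test ∷ w) (long ∷ ls)

longsFirst : ∀ k t m s {w : Vec Decision f} → Phases (k ℕ.+ t) (m ℕ.+ s) w →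
             ∃[ ls ] LongsFirst k t m s w ls
longsFirst zero    zero    zero    zero    []            = [] , []
longsFirst zero    zero    zero    (suc s) (untested∷ φ) with longsFirst 0 0 0 s φ
... | ls , h = short ∷ ls , untestedShort h
longsFirst zero    zero    (suc m) s       (untested∷ φ) with longsFirst 0 0 m s φ
... | ls , h = long ∷ ls , untestedLong h
longsFirst zero    (suc t) m       s       (test∷ φ)     with longsFirst 0 t m s φ
... | ls , h = short ∷ ls , testShort h
longsFirst (suc k) t       m       s       (test∷ φ)     with longsFirst k t m s φ
... | ls , h = long ∷ ls , testLong h

longsFirst-length : ∀ {k t m s} {w : Vec Decision f} {ls} → LongsFirst k t m s w ls →
                    k ℕ.+ t ℕ.+ (m ℕ.+ s) ≡ f
longsFirst-length []                = ≡.refl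
longsFirst-length (untestedShort h) = ≡.cong suc (longsFirst-length h)
longsFirst-length (untestedLong h)  = ≡.cong suc (longsFirst-length h)
longsFirst-length (testShort h)     = ≡.cong suc (longsFirst-length h)
longsFirst-length (testLong h)      = ≡.cong suc (longsFirst-length h)

longsFirst-longs : ∀ {k t m s} {w : Vec Decision f} {ls} → LongsFirst k t m s w ls →
                   longs (toList ls) ≡ k ℕ.+ m
longsFirst-longs []                = ≡.refl
longsFirst-longs (untestedShort h) = longsFirst-longs h
longsFirst-longs (untestedLong h)  = ≡.cong suc (longsFirst-longs h)
longsFirst-longs (testShort h)     = longsFirst-longs h
longsFirst-longs (testLong h)      = ≡.cong suc (longsFirst-longs h)

longJobs-run : ∀ {ps} (σ : Strategy ps f) ls →
               longJobs (run σ ls) ≡ longs ps ℕ.+ longs (toList ls)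
longJobs-run done [] = ≡.refl
longJobs-run {ps = ps} (test k) (l ∷ ls) =
  ≡.trans (longJobs-run (k l) ls) (eq (longCount l) (longs ps) (longs (toList ls)))
  where
  eq : ∀ a b c → a ℕ.+ b ℕ.+ c ≡ b ℕ.+ (a ℕ.+ c)
  eq = solve-∀
longJobs-run (untested k) (short ∷ ls) = longJobs-run (k short) ls
longJobs-run {ps = ps} (untested k) (long ∷ ls) =
  ≡.trans (≡.cong suc (longJobs-run (k long) ls)) (≡.sym (ℕ.+-suc (longs ps) _))
longJobs-run (execute {ps = ps} i σ) ls with lookup ps i | longs ps | longs-removeAt ps i
... | short | _ | ≡.refl = longJobs-run σ ls
... | long  | _ | ≡.refl = ≡.cong suc (longJobs-run σ ls)

pendingDelay-monoˡ : ∀ t k → pendingDelay t k ℕ.≤ pendingDelay (suc t) k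
pendingDelay-monoˡ t zero    = z≤n
pendingDelay-monoˡ t (suc k) = ℕ.+-mono-≤ (ℕ.n≤1+n (t ℕ.+ k)) (pendingDelay-monoˡ t k)

-- The last tested job, if long, is delayed by no later test, and its test delays the earlier
-- pending jobs just as that of a short job does.
pendingDelay-0-suc : ∀ k → pendingDelay 0 (suc k) ≡ pendingDelay 1 k
pendingDelay-0-suc zero    = ≡.refl
pendingDelay-0-suc (suc k) = ≡.cong (suc k ℕ.+_) (pendingDelay-0-suc k)

-- Lower bound on the delay of any strategy with a fixed decision vector.

module NonAdaptiveDelay {c ℓ₁ ℓ₂} (K : OrderedField c ℓ₁ ℓ₂)
  (p x : OrderedField.Carrier K) (0<p : Positive K p) (0<x : Positive K x) where
  open OrderedField K hiding (zero)
  open OrderedFieldProperties K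
  open Game K p x
  open Delay K p x 0<p 0<x

  -- Prepending a test of rank `E` pays for an increase of the bound by any `e ≤ E`; what remains to
  -- check is an inequality of natural numbers.
  add-rank-test : ∀ {q} n n′ e {E D} → e ℕ.≤ E → n ℕ.≤ e ℕ.+ n′ →
                  q + n′ · 1# ≤ D → q + n · 1# ≤ E · 1# + D
  add-rank-test {q} n n′ e {E} {D} e≤E n≤e+n′ h = begin
    q + n · 1#               ≤⟨ +-monoʳ-≤ q (·-monoˡ-≤ 0≤1 n≤e+n′) ⟩
    q + (e ℕ.+ n′) · 1#      ≈⟨ +-congˡ (·-homo-+ 1# e n′) ⟩
    q + (e · 1# + n′ · 1#)   ≈⟨ solve 3 (λ a b c → (a ⊕ (b ⊕ c)) ⊜ (b ⊕ (a ⊕ c))) refl q (e · 1#) (n′ · 1#) ⟩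
    e · 1# + (q + n′ · 1#)   ≤⟨ +-mono-≤ (·-monoˡ-≤ 0≤1 e≤E) h ⟩
    E · 1# + D               ∎
    where open +-Solver

  add-rank-long : ∀ q q′ e {n E D} → e ℕ.≤ E → q ℕ.≤ e ℕ.+ q′ →
                  q′ · x + n ≤ D → q · x + n ≤ E · x + D
  add-rank-long q q′ e {n} {E} {D} e≤E q≤e+q′ h = begin
    q · x + n                ≤⟨ +-monoˡ-≤ n (·-monoˡ-≤ 0≤x q≤e+q′) ⟩
    (e ℕ.+ q′) · x + n       ≈⟨ +-congʳ (·-homo-+ x e q′) ⟩
    e · x + q′ · x + n       ≈⟨ +-assoc _ _ _ ⟩
    e · x + (q′ · x + n)     ≤⟨ +-mono-≤ (·-monoˡ-≤ 0≤x e≤E) h ⟩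
    E · x + D                ∎

  rank : ∀ {n f L d E} → n ≡ f → d ℕ.≤ L → E ≡ f ℕ.+ L → n ℕ.+ d ℕ.≤ E
  rank ≡.refl d≤L ≡.refl = ℕ.+-monoʳ-≤ _ d≤L

  module LowerBound (u : ℕ) (u≤1 : u ℕ.≤ 1) (u≤x : u · 1# ≤ x) where
    open Excess K x u

    -- When only short replies to tests remain, each pending long job pays at least `u` per
    -- remaining test: one unit if kept, or `x` for the short job it delays if executed before.
    delay-lower-short : ∀ {ps w ls t m s} {σ : Strategy ps f} → Follows w σ →
      LongsFirst 0 t m s w ls →
      (triangle (longs ps ℕ.+ m) ℕ.+ m ℕ.* s) · x +
        (testDelay t (m ℕ.+ s) ℕ.+ longs ps ℕ.* (t ℕ.* u)) · 1# ≤ delay (run σ ls)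
    delay-lower-short done [] = ≤-reflexive (+-identityˡ 0#)
    delay-lower-short (untested g) (untestedShort h) = delay-lower-short (g short) h
    delay-lower-short {ps = ps} (untested {k = k} g) (untestedLong {m = m} {s} {ls = ls} h) = add-rank-long
      (triangle (longs ps ℕ.+ suc m) ℕ.+ suc m ℕ.* s) (triangle (longs ps ℕ.+ m) ℕ.+ m ℕ.* s)
      (suc (m ℕ.+ s ℕ.+ longs ps))
      (s≤s (rank (longsFirst-length h) (longs≤length ps) (executions-run (k long) ls)))
      (ℕ.≤-reflexive (≡.trans
        (≡.cong (λ j → triangle j ℕ.+ suc m ℕ.* s) (ℕ.+-suc (longs ps) m))
        (eq (longs ps) m s (triangle (longs ps ℕ.+ m)))))
      (delay-lower-short (g long) h)
      where
      eq : ∀ d m s T → suc (d ℕ.+ m) ℕ.+ T ℕ.+ suc m ℕ.* s ≡ suc (m ℕ.+ s ℕ.+ d) ℕ.+ (T ℕ.+ m ℕ.* s)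
      eq = solve-∀
    delay-lower-short {ps = ps} (test {k = k} g) (testShort {t = t} {m} {s} {ls = ls} h) = add-rank-test
      (testDelay (suc t) (m ℕ.+ s) ℕ.+ longs ps ℕ.* (suc t ℕ.* u))
      (testDelay t (m ℕ.+ s) ℕ.+ longs ps ℕ.* (t ℕ.* u))
      (t ℕ.+ (m ℕ.+ s) ℕ.+ suc (longs ps))
      (rank (longsFirst-length h) (s≤s (longs≤length ps)) (executions-run (k short) ls))
      (ℕ.≤-trans
        (ℕ.+-monoʳ-≤ (testDelay (suc t) (m ℕ.+ s)) (ℕ.*-monoʳ-≤ (longs ps) (ℕ.+-monoˡ-≤ (t ℕ.* u) u≤1)))
        (ℕ.≤-reflexive (eq (longs ps) (m ℕ.+ s) t (testDelay t (m ℕ.+ s)) (t ℕ.* u))))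
      (delay-lower-short (g short) h)
      where
      eq : ∀ d b t T w → suc t ℕ.+ b ℕ.+ T ℕ.+ d ℕ.* suc w ≡ t ℕ.+ b ℕ.+ suc d ℕ.+ (T ℕ.+ d ℕ.* w)
      eq = solve-∀
    delay-lower-short {ps = ps} {ls = ls} {t} {m} {s} (execute {i = i} {σ} g) h
      with lookup ps i | longs ps | longs-removeAt ps i | longs≤length ps
    ... | short | _ | ≡.refl | _ = delay-lower-short g h
    ... | long  | _ | ≡.refl | d<length = begin
      Q · x + (T ℕ.+ (w ℕ.+ d ℕ.* w)) · 1#
        ≈⟨ +-congˡ (trans (·-congˡ (eq₁ T w (d ℕ.* w))) (·-homo-+ 1# w _)) ⟩
      Q · x + (w · 1# + (T ℕ.+ d ℕ.* w) · 1#)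
        ≤⟨ +-monoʳ-≤ _ (+-monoˡ-≤ _ w≤tx) ⟩
      Q · x + (t · x + (T ℕ.+ d ℕ.* w) · 1#)
        ≈⟨ +-assoc _ _ _ ⟨
      Q · x + t · x + (T ℕ.+ d ℕ.* w) · 1#
        ≈⟨ +-congʳ (·-homo-+ x Q t) ⟨
      (Q ℕ.+ t) · x + (T ℕ.+ d ℕ.* w) · 1#
        ≤⟨ add-rank-long (Q ℕ.+ t) (triangle (d ℕ.+ m) ℕ.+ m ℕ.* s) (t ℕ.+ (m ℕ.+ s) ℕ.+ suc d)
             (rank (longsFirst-length h) d<length (executions-run (execute {ps = ps} i σ) ls))
             (ℕ.≤-trans (ℕ.m≤m+n _ s) (ℕ.≤-reflexive (eq₂ d m s t (triangle (d ℕ.+ m)))))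
             (delay-lower-short g h) ⟩
      suc (executions (run σ ls)) · x + delay (run σ ls) ∎
      where
      d w T Q : ℕ
      d = longs (removeAt ps i)
      w = t ℕ.* u
      T = testDelay t (m ℕ.+ s)
      Q = triangle (suc d ℕ.+ m) ℕ.+ m ℕ.* s
      w≤tx : w · 1# ≤ t · x
      w≤tx = ≤-trans (≤-reflexive (sym (·-assocˡ 1# t u))) (·-monoʳ-≤ t u≤x)
      eq₁ : ∀ T w y → T ℕ.+ (w ℕ.+ y) ≡ w ℕ.+ (T ℕ.+ y)
      eq₁ = solve-∀
      eq₂ : ∀ d m s t y → suc (d ℕ.+ m) ℕ.+ y ℕ.+ m ℕ.* s ℕ.+ t ℕ.+ s ≡ t ℕ.+ (m ℕ.+ s) ℕ.+ suc d ℕ.+ (y ℕ.+ m ℕ.* s)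
      eq₂ = solve-∀

    -- The price of one pending long job with `t + k` tests and `z` short jobs to come, as summed in
    -- `earlyDelay`.
    early : ℕ → ℕ → ℕ → Carrier
    early k t z = min (((t ℕ.+ k) ℕ.* u) · 1#) (z · x)

    early-suc : ∀ k t z → early (suc k) t z ≤ 1# + early k t z
    early-suc k t z = ≤-+-⊓
      (≤-trans (x⊓y≤x _ _) (≤-trans (·-monoˡ-≤ 0≤1 (ℕ.≤-trans
        (ℕ.≤-reflexive (≡.cong (ℕ._* u) (ℕ.+-suc t k))) (ℕ.+-monoˡ-≤ ((t ℕ.+ k) ℕ.* u) u≤1))) ≤-refl))
      (≤-trans (x⊓y≤y _ _) (x≤y+x 0≤1))

    -- A potential argument: each pending long job holds the price `early`. A test costs it one unit
    -- and lowers its price by at most one, by `early-suc`; executing it costs the `z · x` that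
    -- bounds its price. A newly tested long job adds its own summand of `earlyDelay`.
    delay-lower : ∀ {ps w ls k t m s} {σ : Strategy ps f} → Follows w σ →
      LongsFirst k t m s w ls →
      (triangle (longs ps ℕ.+ (k ℕ.+ m)) ℕ.+ m ℕ.* s) · x +
        (testDelay (k ℕ.+ t) (m ℕ.+ s) · 1# +
          (longs ps · early k t (t ℕ.+ s) + earlyDelay t k (t ℕ.+ s))) ≤ delay (run σ ls)
    delay-lower {ps = ps} {ls = ls} {zero} {t} {m} {s} {σ} g h = begin
      Q · x + (T · 1# + (d · early 0 t z + 0#))
        ≤⟨ +-monoʳ-≤ _ (+-monoʳ-≤ _ (≤-trans (≤-reflexive (+-identityʳ _)) (·-monoʳ-≤ d (x⊓y≤x _ _)))) ⟩
      Q · x + (T · 1# + d · (((t ℕ.+ 0) ℕ.* u) · 1#))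
        ≈⟨ +-congˡ (+-congˡ (trans (·-assocˡ 1# d _) (·-congˡ (≡.cong (λ j → d ℕ.* (j ℕ.* u)) (ℕ.+-identityʳ t))))) ⟩
      Q · x + (T · 1# + (d ℕ.* (t ℕ.* u)) · 1#)
        ≈⟨ +-congˡ (·-homo-+ 1# T _) ⟨
      Q · x + (T ℕ.+ d ℕ.* (t ℕ.* u)) · 1#
        ≤⟨ delay-lower-short g h ⟩
      delay (run σ ls) ∎
      where
      d z T Q : ℕ
      d = longs ps
      z = t ℕ.+ s
      T = testDelay t (m ℕ.+ s)
      Q = triangle (d ℕ.+ m) ℕ.+ m ℕ.* s
    delay-lower {ps = ps} {k = suc k} {t} {m} {s} (test {k = τ} g) (testLong {ls = ls} h) = begin
      Q · x + (testDelay (suc k ℕ.+ t) b · 1# + (d · early (suc k) t z + (W + M)))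
        ≤⟨ +-monoʳ-≤ _ (+-monoʳ-≤ _ (+-monoˡ-≤ _ (≤-trans
             (·-monoʳ-≤ d (early-suc k t z)) (≤-reflexive (·-distribˡ-+ d 1# W))))) ⟩
      Q · x + (testDelay (suc k ℕ.+ t) b · 1# + (d · 1# + d · W + (W + M)))
        ≈⟨ +-congˡ (solve 5 (λ B D E W M → (B ⊕ ((D ⊕ E) ⊕ (W ⊕ M))) ⊜ ((W ⊕ E ⊕ M) ⊕ (B ⊕ D))) refl
             (testDelay (suc k ℕ.+ t) b · 1#) (d · 1#) (d · W) W M) ⟩
      Q · x + (W + (d · W + M) + (testDelay (suc k ℕ.+ t) b · 1# + d · 1#))
        ≈⟨ +-assoc _ _ _ ⟨
      Q · x + (W + (d · W + M)) + (testDelay (suc k ℕ.+ t) b · 1# + d · 1#)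
        ≈⟨ +-congˡ (·-homo-+ 1# (testDelay (suc k ℕ.+ t) b) d) ⟨
      Q · x + (W + (d · W + M)) + (testDelay (suc k ℕ.+ t) b ℕ.+ d) · 1#
        ≤⟨ add-rank-test (testDelay (suc k ℕ.+ t) b ℕ.+ d) T (k ℕ.+ t ℕ.+ b ℕ.+ suc d)
             (rank (longsFirst-length h) (s≤s (longs≤length ps)) (executions-run (τ long) ls))
             (ℕ.≤-reflexive (eq (k ℕ.+ t) b d T))
             (≤-trans (≤-reflexive (trans
               (+-cong (+-congʳ (·-congˡ (≡.cong (λ j → triangle j ℕ.+ m ℕ.* s) (ℕ.+-suc d (k ℕ.+ m))))) refl)
               (solve 5 (λ Q W E M T → ((Q ⊕ (W ⊕ (E ⊕ M))) ⊕ T) ⊜ (Q ⊕ (T ⊕ ((W ⊕ E) ⊕ M)))) refl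
                 _ W (d · W) M (T · 1#))))
               (delay-lower (g long) h)) ⟩
      executions (run (τ long) ls) · 1# + delay (run (τ long) ls) ∎
      where
      open +-Solver
      d z b T Q : ℕ
      d = longs ps
      z = t ℕ.+ s
      b = m ℕ.+ s
      T = testDelay (k ℕ.+ t) b
      Q = triangle (d ℕ.+ (suc k ℕ.+ m)) ℕ.+ m ℕ.* s
      W M : Carrier
      W = early k t z
      M = earlyDelay t k z
      eq : ∀ a b d T → suc a ℕ.+ b ℕ.+ T ℕ.+ d ≡ a ℕ.+ b ℕ.+ suc d ℕ.+ T
      eq = solve-∀
    delay-lower {ps = ps} {ls = ls} {suc k} {t} {m} {s} (execute {i = i} {σ} g) h
      with lookup ps i | longs ps | longs-removeAt ps i | longs≤length ps
    ... | short | _ | ≡.refl | _ = delay-lower g h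
    ... | long  | _ | ≡.refl | d<length = begin
      Q · x + (T · 1# + (W + d · W + M))
        ≤⟨ +-monoʳ-≤ _ (+-monoʳ-≤ _ (+-monoˡ-≤ _ (+-monoˡ-≤ _ (x⊓y≤y _ _)))) ⟩
      Q · x + (T · 1# + (z · x + d · W + M))
        ≈⟨ solve 5 (λ Q T z E M → (Q ⊕ (T ⊕ ((z ⊕ E) ⊕ M))) ⊜ ((Q ⊕ z) ⊕ (T ⊕ (E ⊕ M)))) refl
             (Q · x) (T · 1#) (z · x) (d · W) M ⟩
      Q · x + z · x + (T · 1# + (d · W + M))
        ≈⟨ +-congʳ (·-homo-+ x Q z) ⟨
      (Q ℕ.+ z) · x + (T · 1# + (d · W + M))
        ≤⟨ add-rank-long (Q ℕ.+ z) (triangle (d ℕ.+ (suc k ℕ.+ m)) ℕ.+ m ℕ.* s)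
             (suc k ℕ.+ t ℕ.+ (m ℕ.+ s) ℕ.+ suc d)
             (rank (longsFirst-length h) d<length (executions-run (execute {ps = ps} i σ) ls))
             (ℕ.≤-reflexive (eq d k m s t (triangle (d ℕ.+ (suc k ℕ.+ m)))))
             (delay-lower g h) ⟩
      suc (executions (run σ ls)) · x + delay (run σ ls) ∎
      where
      open +-Solver
      d z T Q : ℕ
      d = longs (removeAt ps i)
      z = t ℕ.+ s
      T = testDelay (suc k ℕ.+ t) (m ℕ.+ s)
      Q = triangle (suc d ℕ.+ (suc k ℕ.+ m)) ℕ.+ m ℕ.* s
      W M : Carrier
      W = early (suc k) t z
      M = earlyDelay t (suc k) z
      eq : ∀ d k m s t y → suc d ℕ.+ (suc k ℕ.+ m) ℕ.+ y ℕ.+ m ℕ.* s ℕ.+ (t ℕ.+ s) ≡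
           suc k ℕ.+ t ℕ.+ (m ℕ.+ s) ℕ.+ suc d ℕ.+ (y ℕ.+ m ℕ.* s)
      eq = solve-∀

-- Upper bound for postponing strategies and non-adaptive optimality.

module NonAdaptiveOptimality {c ℓ₁ ℓ₂} (K : OrderedField c ℓ₁ ℓ₂)
  (p x : OrderedField.Carrier K) (0<p : Positive K p) (0<x : Positive K x) where
  open OrderedField K hiding (zero)
  open OrderedFieldProperties K
  open Game K p x
  open Delay K p x 0<p 0<x
  open NonAdaptiveDelay K p x 0<p 0<x

  -- The `d` long jobs pending at the start are each delayed by all `a` tests, hence the term
  -- `d * a`.
  DelayBound : ∀ (a b d : ℕ) → Vec Length f → Carrier → Set ℓ₂
  DelayBound a b d ls D = ∃[ k ] ∃[ t ] ∃[ m ] ∃[ s ]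
    k ℕ.+ t ≡ a × m ℕ.+ s ≡ b × longs (toList ls) ≡ k ℕ.+ m ×
    D ≤ (triangle (d ℕ.+ (k ℕ.+ m)) ℕ.+ m ℕ.* s) · x +
        (testDelay a b ℕ.+ d ℕ.* a ℕ.+ pendingDelay t k) · 1#

  raise-rank-test : ∀ {q} n n′ e {E D} → E ≡ e → e ℕ.+ n ℕ.≤ n′ →
                    D ≤ q + n · 1# → E · 1# + D ≤ q + n′ · 1#
  raise-rank-test {q} n n′ e {D = D} ≡.refl e+n≤n′ h = begin
    e · 1# + D               ≤⟨ +-monoʳ-≤ _ h ⟩
    e · 1# + (q + n · 1#)    ≈⟨ solve 3 (λ a b c → (b ⊕ (a ⊕ c)) ⊜ (a ⊕ (b ⊕ c))) refl q (e · 1#) (n · 1#) ⟩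
    q + (e · 1# + n · 1#)    ≈⟨ +-congˡ (·-homo-+ 1# e n) ⟨
    q + (e ℕ.+ n) · 1#       ≤⟨ +-monoʳ-≤ q (·-monoˡ-≤ 0≤1 e+n≤n′) ⟩
    q + n′ · 1#              ∎
    where open +-Solver

  raise-rank-long : ∀ q q′ e {n E D} → E ≡ e → e ℕ.+ q ℕ.≤ q′ →
                    D ≤ q · x + n → E · x + D ≤ q′ · x + n
  raise-rank-long q q′ e {n} {D = D} ≡.refl e+q≤q′ h = begin
    e · x + D                ≤⟨ +-monoʳ-≤ _ h ⟩
    e · x + (q · x + n)      ≈⟨ +-assoc _ _ _ ⟨
    e · x + q · x + n        ≈⟨ +-congʳ (·-homo-+ x e q) ⟨
    (e ℕ.+ q) · x + n        ≤⟨ +-monoˡ-≤ n (·-monoˡ-≤ 0≤x e+q≤q′) ⟩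
    q′ · x + n               ∎

  -- Long replies first are the worst order in each phase: a short reply in front adds no more than
  -- the bound grants it, by `pendingDelay-monoˡ` in the first phase and `m * s ≤ m * suc s` in the
  -- second.
  delay-upper : ∀ {a b} {w : Vec Decision f} → Phases a b w → ∀ d ls →
                DelayBound a b d ls (delay (run (postpone d (fixed w)) ls))
  delay-upper [] d [] = 0 , 0 , 0 , 0 , ≡.refl , ≡.refl , ≡.refl , bound d
    where
    bound : ∀ d → delay (run (postpone d done) []) ≤
            (triangle (d ℕ.+ 0) ℕ.+ 0) · x + (d ℕ.* 0 ℕ.+ 0) · 1#
    bound zero    = ≤-reflexive (sym (+-identityˡ 0#))
    bound (suc d) = raise-rank-long (triangle (d ℕ.+ 0) ℕ.+ 0) (triangle (suc d ℕ.+ 0) ℕ.+ 0) (suc d)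
      (≡.cong suc (executions-postpone d done []))
      (ℕ.≤-reflexive (≡.trans
        (≡.cong (λ e → suc e ℕ.+ (triangle (d ℕ.+ 0) ℕ.+ 0)) (≡.sym (ℕ.+-identityʳ d)))
        (≡.sym (ℕ.+-assoc (suc (d ℕ.+ 0)) (triangle (d ℕ.+ 0)) 0))))
      (bound d)
  delay-upper {b = suc b} (untested∷ φ) d (short ∷ ls) with delay-upper φ d ls
  ... | 0 , 0 , m , s , _ , m+s≡b , longs≡ , h =
    0 , 0 , m , suc s , ≡.refl , ≡.trans (ℕ.+-suc m s) (≡.cong suc m+s≡b) , longs≡ ,
    ≤-trans h (+-monoˡ-≤ _ (·-monoˡ-≤ 0≤x
      (ℕ.+-monoʳ-≤ (triangle (d ℕ.+ m)) (ℕ.*-monoʳ-≤ m (ℕ.n≤1+n s)))))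
  delay-upper {b = suc b} (untested∷_ {w = w} φ) d (long ∷ ls) with delay-upper φ d ls
  ... | 0 , 0 , m , s , _ , ≡.refl , longs≡ , h =
    0 , 0 , suc m , s , ≡.refl , ≡.refl , ≡.cong suc longs≡ ,
    raise-rank-long (triangle (d ℕ.+ m) ℕ.+ m ℕ.* s) (triangle (d ℕ.+ suc m) ℕ.+ suc m ℕ.* s)
      (suc (m ℕ.+ s ℕ.+ d))
      (≡.cong suc (≡.trans (executions-postpone d (fixed w) ls) (≡.cong (ℕ._+ d) (≡.sym (phases-length φ)))))
      (ℕ.≤-reflexive (≡.trans (eq d m s (triangle (d ℕ.+ m)))
        (≡.cong (λ j → triangle j ℕ.+ suc m ℕ.* s) (≡.sym (ℕ.+-suc d m)))))
      h
    where
    eq : ∀ d m s T → suc (m ℕ.+ s ℕ.+ d) ℕ.+ (T ℕ.+ m ℕ.* s) ≡ suc (d ℕ.+ m) ℕ.+ T ℕ.+ suc m ℕ.* s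
    eq = solve-∀
  delay-upper {a = suc a} {b} (test∷_ {w = w} φ) d (short ∷ ls) with delay-upper φ d ls
  ... | k , t , m , s , k+t≡a , m+s≡b , longs≡ , h =
    k , suc t , m , s , ≡.trans (ℕ.+-suc k t) (≡.cong suc k+t≡a) , m+s≡b , longs≡ ,
    raise-rank-test (testDelay a b ℕ.+ d ℕ.* a ℕ.+ pendingDelay t k) _ (suc (a ℕ.+ b ℕ.+ d))
      (≡.cong suc (≡.trans (executions-postpone d (fixed w) ls) (≡.cong (ℕ._+ d) (≡.sym (phases-length φ)))))
      (ℕ.≤-trans (ℕ.≤-reflexive (eq a b d (testDelay a b) (pendingDelay t k)))
        (ℕ.+-monoʳ-≤ (testDelay (suc a) b ℕ.+ d ℕ.* suc a) (pendingDelay-monoˡ t k)))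
      h
    where
    eq : ∀ a b d T P → suc (a ℕ.+ b ℕ.+ d) ℕ.+ (T ℕ.+ d ℕ.* a ℕ.+ P) ≡ suc a ℕ.+ b ℕ.+ T ℕ.+ d ℕ.* suc a ℕ.+ P
    eq = solve-∀
  delay-upper {a = suc a} {b} (test∷_ {w = w} φ) d (long ∷ ls) with delay-upper φ (suc d) ls
  ... | k , t , m , s , ≡.refl , m+s≡b , longs≡ , h =
    suc k , t , m , s , ≡.refl , m+s≡b , ≡.cong suc longs≡ ,
    ≤-trans (raise-rank-test (testDelay a b ℕ.+ suc d ℕ.* a ℕ.+ pendingDelay t k)
      (testDelay (suc a) b ℕ.+ d ℕ.* suc a ℕ.+ pendingDelay t (suc k)) (a ℕ.+ b ℕ.+ suc d)
      (≡.trans (executions-postpone (suc d) (fixed w) ls) (≡.cong (ℕ._+ suc d) (≡.sym (phases-length φ))))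
      (ℕ.≤-reflexive (eq k t b d (testDelay a b) (pendingDelay t k)))
      h)
      (+-monoˡ-≤ _ (≤-reflexive (·-congˡ (≡.cong (λ j → triangle j ℕ.+ m ℕ.* s) (≡.sym (ℕ.+-suc d (k ℕ.+ m)))))))
    where
    eq : ∀ k t b d T P → k ℕ.+ t ℕ.+ b ℕ.+ suc d ℕ.+ (T ℕ.+ suc d ℕ.* (k ℕ.+ t) ℕ.+ P) ≡
         suc (k ℕ.+ t) ℕ.+ b ℕ.+ T ℕ.+ d ℕ.* suc (k ℕ.+ t) ℕ.+ (t ℕ.+ k ℕ.+ P)
    eq = solve-∀

  v≤maxOverLengths : ∀ n v (ls : Vec Length n) → v ls ≤ maxOverLengths n v
  v≤maxOverLengths zero    v []           = ≤-refl
  v≤maxOverLengths (suc n) v (short ∷ ls) = ≤-trans (v≤maxOverLengths n _ ls) (x≤x⊔y _ _)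
  v≤maxOverLengths (suc n) v (long ∷ ls)  = ≤-trans (v≤maxOverLengths n _ ls) (x≤y⊔x _ _)

  maxOverLengths-lub : ∀ n v {r} → (∀ (ls : Vec Length n) → v ls ≤ r) → maxOverLengths n v ≤ r
  maxOverLengths-lub zero    v h = h []
  maxOverLengths-lub (suc n) v h = ⊔-lub
    (maxOverLengths-lub n _ λ ls → h (short ∷ ls)) (maxOverLengths-lub n _ λ ls → h (long ∷ ls))

  module _ (n₀ : ℕ) where
    private
      n : ℕ
      n = suc n₀

    -- The delay over `OPT` that ratio `r` permits with `ℓ` long jobs.
    slack : Carrier → ℕ → Carrier
    slack r ℓ = (r + - 1#) * OPT n ℓ

    OPT+slack : ∀ r ℓ → OPT n ℓ + slack r ℓ ≈ r * OPT n ℓ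
    OPT+slack r ℓ = begin-equality
      OPT n ℓ + (r + - 1#) * OPT n ℓ        ≈⟨ +-congʳ (*-identityˡ _) ⟨
      1# * OPT n ℓ + (r + - 1#) * OPT n ℓ   ≈⟨ distribʳ _ _ _ ⟨
      (1# + (r + - 1#)) * OPT n ℓ           ≈⟨ *-congʳ (trans (+-comm 1# _) (trans (+-assoc r (- 1#) 1#)
                                                 (trans (+-congˡ (-‿inverseˡ 1#)) (+-identityʳ r)))) ⟩
      r * OPT n ℓ                           ∎

    slack-suc : ∀ r ℓ → slack r (suc ℓ) ≈ slack r ℓ + (r + - 1#) * (suc ℓ · x)
    slack-suc r ℓ = begin-equality
      (r + - 1#) * (tri p n + tri x (suc ℓ))             ≈⟨ *-congˡ (+-congˡ (trans (tri-suc x ℓ) (+-comm _ _))) ⟩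
      (r + - 1#) * (tri p n + (tri x ℓ + suc ℓ · x))     ≈⟨ *-congˡ (+-assoc _ _ _) ⟨
      (r + - 1#) * (OPT n ℓ + suc ℓ · x)                 ≈⟨ distribˡ _ _ _ ⟩
      slack r ℓ + (r + - 1#) * (suc ℓ · x)               ∎

    excess≤slack : ∀ {r e} (σ : Algorithm n) ls → scheduleRatio n (run σ ls) ≤ r →
      triangle (longs (toList ls)) · x + e ≤ delay (run σ ls) → e ≤ slack r (longs (toList ls))
    excess≤slack {r} {e} σ ls ratio≤r e≤ = +-cancelˡ-≤ (OPT n ℓ) (begin
      tri p n + tri x ℓ + e               ≈⟨ +-assoc _ _ _ ⟩
      tri p n + (tri x ℓ + e)             ≈⟨ +-congˡ (+-congʳ (tri≈triangle x ℓ)) ⟩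
      tri p n + (triangle ℓ · x + e)      ≤⟨ +-monoʳ-≤ _ e≤ ⟩
      tri p n + delay (run σ ls)          ≈⟨ cost-run σ ls ⟨
      costFrom 0# (run σ ls)              ≤⟨ /≤⇒≤* (0<OPT n₀ (longJobs (run σ ls))) ratio≤r ⟩
      r * OPT n (longJobs (run σ ls))     ≈⟨ *-congˡ (reflexive (≡.cong (OPT n) (longJobs-run σ ls))) ⟩
      r * OPT n ℓ                         ≈⟨ OPT+slack r ℓ ⟨
      OPT n ℓ + slack r ℓ                 ∎)
      where
      ℓ : ℕ
      ℓ = longs (toList ls)

    ratio≤ : ∀ {r e} (σ : Algorithm n) ls →
      delay (run σ ls) ≤ triangle (longs (toList ls)) · x + e → e ≤ slack r (longs (toList ls)) →
      scheduleRatio n (run σ ls) ≤ r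
    ratio≤ {r} {e} σ ls delay≤ e≤ = ≤*⇒/≤ (0<OPT n₀ (longJobs (run σ ls))) (begin
      costFrom 0# (run σ ls)              ≈⟨ cost-run σ ls ⟩
      tri p n + delay (run σ ls)          ≤⟨ +-monoʳ-≤ _ delay≤ ⟩
      tri p n + (triangle ℓ · x + e)      ≈⟨ +-congˡ (+-congʳ (tri≈triangle x ℓ)) ⟨
      tri p n + (tri x ℓ + e)             ≈⟨ +-assoc _ _ _ ⟨
      tri p n + tri x ℓ + e               ≤⟨ +-monoʳ-≤ _ e≤ ⟩
      OPT n ℓ + slack r ℓ                 ≈⟨ OPT+slack r ℓ ⟩
      r * OPT n ℓ                         ≈⟨ *-congˡ (reflexive (≡.cong (OPT n) (longJobs-run σ ls))) ⟨
      r * OPT n (longJobs (run σ ls))     ∎)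
      where
      ℓ : ℕ
      ℓ = longs (toList ls)

    Achievable : Carrier → ℕ → ℕ → Set ℓ₂
    Achievable r a b = ∀ k t m s → k ℕ.+ t ≡ a → m ℕ.+ s ≡ b →
      (m ℕ.* s) · x + (testDelay a b ℕ.+ pendingDelay t k) · 1# ≤ slack r (k ℕ.+ m)

    achieve : ∀ {r a b} {w : Vec Decision n} → Phases a b w → Achievable r a b →
              nonAdaptiveRatio (postpone 0 (fixed w)) ≤ r
    achieve {r} {a} {b} {w} φ ok = maxOverLengths-lub n _ λ ls → bound ls (delay-upper φ 0 ls)
      where
      bound : ∀ ls → DelayBound a b 0 ls (delay (run (postpone 0 (fixed w)) ls)) →
              scheduleRatio n (run (postpone 0 (fixed w)) ls) ≤ r
      bound ls (k , t , m , s , k+t≡a , m+s≡b , longs≡ , h) = ratio≤ (postpone 0 (fixed w)) ls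
        (≤-trans h (≤-reflexive (begin-equality
          (triangle (k ℕ.+ m) ℕ.+ m ℕ.* s) · x + (testDelay a b ℕ.+ 0 ℕ.+ pendingDelay t k) · 1#
            ≈⟨ +-cong (·-homo-+ x (triangle (k ℕ.+ m)) (m ℕ.* s))
                 (·-congˡ (≡.cong (ℕ._+ pendingDelay t k) (ℕ.+-identityʳ (testDelay a b)))) ⟩
          triangle (k ℕ.+ m) · x + (m ℕ.* s) · x + (testDelay a b ℕ.+ pendingDelay t k) · 1#
            ≈⟨ +-assoc _ _ _ ⟩
          triangle (k ℕ.+ m) · x + ((m ℕ.* s) · x + (testDelay a b ℕ.+ pendingDelay t k) · 1#)
            ≈⟨ +-congʳ (·-congˡ (≡.cong triangle longs≡)) ⟨
          triangle (longs (toList ls)) · x + ((m ℕ.* s) · x + (testDelay a b ℕ.+ pendingDelay t k) · 1#) ∎)))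
        (≤-trans (ok k t m s k+t≡a m+s≡b) (≤-reflexive (reflexive (≡.cong (slack r) (≡.sym longs≡)))))

    module Improve {a b : ℕ} {w : Vec Decision n} (σ : Algorithm n) (g : Follows w σ)
      (φ : Phases a b w) (u : ℕ) (u≤1 : u ℕ.≤ 1) (u≤x : u · 1# ≤ x) (x≤1⊎u≡1 : x ≤ 1# ⊎ u ≡ 1)
      where
      open Excess K x u
      open LowerBound u u≤1 u≤x

      r : Carrier
      r = nonAdaptiveRatio σ

      lowerExcess≤slack : ∀ k t m s → k ℕ.+ t ≡ a → m ℕ.+ s ≡ b → lowerExcess k t m s ≤ slack r (k ℕ.+ m)
      lowerExcess≤slack k t m s ≡.refl ≡.refl with longsFirst k t m s φ
      ... | ls , h = ≡.subst (λ ℓ → lowerExcess k t m s ≤ slack r ℓ) (longsFirst-longs h)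
        (excess≤slack σ ls (v≤maxOverLengths n (scheduleRatio n ∘ run σ) ls) (begin
          triangle (longs (toList ls)) · x + (T + E + (m ℕ.* s) · x)
            ≈⟨ +-congʳ (·-congˡ (≡.cong triangle (longsFirst-longs h))) ⟩
          triangle (k ℕ.+ m) · x + (T + E + (m ℕ.* s) · x)
            ≈⟨ solve 4 (λ Q T E X → (Q ⊕ ((T ⊕ E) ⊕ X)) ⊜ ((Q ⊕ X) ⊕ (T ⊕ E))) refl
                 (triangle (k ℕ.+ m) · x) T E ((m ℕ.* s) · x) ⟩
          triangle (k ℕ.+ m) · x + (m ℕ.* s) · x + (T + E)
            ≈⟨ +-cong (·-homo-+ x (triangle (k ℕ.+ m)) (m ℕ.* s)) (+-congˡ (+-identityˡ E)) ⟨
          (triangle (k ℕ.+ m) ℕ.+ m ℕ.* s) · x + (T + (0# + E))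
            ≤⟨ delay-lower g h ⟩
          delay (run σ ls) ∎))
        where
        open +-Solver
        T E : Carrier
        T = testDelay (k ℕ.+ t) (m ℕ.+ s) · 1#
        E = earlyDelay t k (t ℕ.+ s)

      -- If all jobs are short, the excess is nonnegative and within `slack r 0`, while `OPT` is
      -- positive.
      0≤r-1 : 0# ≤ r + - 1#
      0≤r-1 = begin
        0#                   ≈⟨ zeroˡ _ ⟨
        0# / OPT n 0         ≤⟨ /-monoˡ-≤ (0<OPT n₀ 0) (≤-trans
                                  (+-nonneg (+-nonneg (·-nonneg (testDelay a b) 0≤1) ≤-refl) ≤-refl)
                                  (lowerExcess≤slack 0 a 0 b ≡.refl ≡.refl)) ⟩
        slack r 0 / OPT n 0  ≈⟨ /-*-cancel (0<OPT n₀ 0) ⟩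
        r + - 1#             ∎

      slackStep : ℕ → Carrier
      slackStep ℓ = (r + - 1#) * (suc ℓ · x)

      slackStep-nonneg : ∀ ℓ → 0# ≤ slackStep ℓ
      slackStep-nonneg ℓ = *-nonneg 0≤r-1 (·-nonneg (suc ℓ) 0≤x)

      slackStep-mono : ∀ {i j} → i ℕ.≤ j → slackStep i ≤ slackStep j
      slackStep-mono {i} {j} i≤j = begin
        (r + - 1#) * (suc i · x)   ≈⟨ *-comm _ _ ⟩
        suc i · x * (r + - 1#)     ≤⟨ *-monoʳ-≤ 0≤r-1 (·-monoˡ-≤ 0≤x (s≤s i≤j)) ⟩
        suc j · x * (r + - 1#)     ≈⟨ *-comm _ _ ⟩
        (r + - 1#) * (suc j · x)   ∎

      open Exchange 0≤x x≤1⊎u≡1 (slack r) slackStep (slack-suc r) slackStep-mono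

      upper⇒achievable : ∀ {a b} → Upper a b → Achievable r (suc a) b
      upper⇒achievable {a} upper k (suc t) m s k+1+t≡1+a ≡.refl = begin
        (m ℕ.* s) · x + (testDelay (suc a) (m ℕ.+ s) ℕ.+ pendingDelay (suc t) k) · 1#
          ≈⟨ +-comm _ _ ⟩
        (testDelay (suc a) (m ℕ.+ s) ℕ.+ pendingDelay (suc t) k) · 1# + (m ℕ.* s) · x
          ≈⟨ +-congʳ (·-congˡ (≡.cong (λ a → testDelay a (m ℕ.+ s) ℕ.+ pendingDelay (suc t) k) k+1+t≡1+a)) ⟨
        upperExcess k (suc t) m s
          ≤⟨ upper k t m s (ℕ.suc-injective (≡.trans (≡.sym (ℕ.+-suc k t)) k+1+t≡1+a)) ≡.refl ⟩
        slack r (k ℕ.+ m) ∎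
      -- If every tested job is long, the last one is regarded as short: the excess is the same by
      -- `pendingDelay-0-suc`, and the slack is only smaller.
      upper⇒achievable {a} upper (suc k) zero m s k+0≡1+a ≡.refl = begin
        (m ℕ.* s) · x + (testDelay (suc a) (m ℕ.+ s) ℕ.+ pendingDelay 0 (suc k)) · 1#
          ≈⟨ +-comm _ _ ⟩
        (testDelay (suc a) (m ℕ.+ s) ℕ.+ pendingDelay 0 (suc k)) · 1# + (m ℕ.* s) · x
          ≈⟨ +-congʳ (·-congˡ (≡.cong₂ (λ a P → testDelay a (m ℕ.+ s) ℕ.+ P)
               (≡.trans (≡.sym k+0≡1+a) (≡.sym (ℕ.+-suc k 0))) (pendingDelay-0-suc k))) ⟩
        upperExcess k 1 m s
          ≤⟨ upper k 0 m s (ℕ.suc-injective k+0≡1+a) ≡.refl ⟩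
        slack r (k ℕ.+ m)
          ≤⟨ x≤x+y (slackStep-nonneg (k ℕ.+ m)) ⟩
        slack r (k ℕ.+ m) + slackStep (k ℕ.+ m)
          ≈⟨ slack-suc r (k ℕ.+ m) ⟨
        slack r (suc k ℕ.+ m) ∎

      achievable : ∃[ a′ ] ∃[ b′ ] a′ ℕ.+ b′ ≡ n × Achievable r a′ b′
      achievable = from a ≡.refl
        where
        from : ∀ c → a ≡ c → ∃[ a′ ] ∃[ b′ ] a′ ℕ.+ b′ ≡ n × Achievable r a′ b′
        -- Without tests nothing is ever pending, so the lower bound is already the postponing
        -- excess.
        from zero ≡.refl = 0 , b , phases-length φ , λ { 0 0 m s _ m+s≡b →
          ≤-trans (≤-reflexive (trans (+-comm _ _) (+-congʳ (sym (+-identityʳ 0#)))))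
            (lowerExcess≤slack 0 0 m s ≡.refl m+s≡b) }
        from (suc c) ≡.refl with lower⇒upper c b (λ k t m s k+t≡c m+s≡b →
               lowerExcess≤slack k (suc t) m s (≡.trans (ℕ.+-suc k t) (≡.cong suc k+t≡c)) m+s≡b)
        ... | a′ , b′ , a′+b′≡ , upper =
          suc a′ , b′ , ≡.trans (≡.cong suc a′+b′≡) (phases-length φ) , upper⇒achievable upper

    improve : ∀ {a b} {w : Vec Decision n} (σ : Algorithm n) → Follows w σ → Phases a b w →
      ∃[ a′ ] ∃[ b′ ] a′ ℕ.+ b′ ≡ n × Achievable (nonAdaptiveRatio σ) a′ b′
    improve σ g φ with total x 1#
    ... | inj₁ x≤1 = Improve.achievable σ g φ 0 z≤n 0≤x (inj₁ x≤1)
    ... | inj₂ 1≤x = Improve.achievable σ g φ 1 ℕ.≤-refl (≤-trans (≤-reflexive (+-identityʳ 1#)) 1≤x) (inj₂ ≡.refl)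

    nonAdaptive-optimal : Σ[ σ ∈ Algorithm n ] TwoPhase σ × NonAdaptiveOptimal σ →
                          Σ[ σ ∈ Algorithm n ] Postponing σ × NonAdaptiveOptimal σ
    nonAdaptive-optimal (σ , twoPhase , (w , g) , optimal) with twoPhase-phases twoPhase g
    ... | a , b , φ with improve σ g φ
    ...   | a′ , b′ , a′+b′≡n , ok with phases a′ b′ a′+b′≡n
    ...     | w′ , φ′ = postpone 0 (fixed w′) , postpone-postponing 0 (fixed w′) ,
      (w′ , postpone-follows 0 w′) , λ τ nonAdaptive → ≤-trans (achieve φ′ ok) (optimal τ nonAdaptive)

lemma2 : ∀ {c ℓ₁ ℓ₂} (K : OrderedField c ℓ₁ ℓ₂) → let open OrderedField K in
    TwoPhaseConjecture K →
    ∀ p x → 0# < p → 0# < x → ∀ n → let open Game K p x in let open GameTree n in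
    (Σ[ σ ∈ Algorithm n ] Postponing σ × AdaptiveOptimal σ) ×
    (Σ[ σ ∈ Algorithm n ] Postponing σ × NonAdaptiveOptimal σ) ×
    (∀ {c d e f} → Node c d e f → ratio c d e f ≈ ratio′ c d e f)
-- With no jobs `OPT` is not positive at the root, but `done` is the only algorithm, and all nodes
-- have `f ≡ 0`, where both ratios are the same leaf value.
lemma2 K conjecture p x 0<p 0<x zero =
  (done , done , λ { done → ≤-refl }) ,
  (done , done , ([] , done) , λ { done _ → ≤-refl }) ,
  λ ν → leaf ν (no-jobs ν)
  where
  open OrderedField K using (_≈_; refl)
  open OrderedFieldProperties K using (≤-refl)
  open Game K p x
  open GameTree 0
  no-jobs : ∀ {c d e f} → Node c d e f → f ≡ 0
  no-jobs root = ≡.refl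
  no-jobs (testShort ν)     = contradiction (no-jobs ν) λ ()
  no-jobs (testLong ν)      = contradiction (no-jobs ν) λ ()
  no-jobs (untestedShort ν) = contradiction (no-jobs ν) λ ()
  no-jobs (untestedLong ν)  = contradiction (no-jobs ν) λ ()
  no-jobs (executeLong ν)   = no-jobs ν
  leaf : ∀ {c d e f} → Node c d e f → f ≡ 0 → ratio c d e f ≈ ratio′ c d e f
  leaf _ ≡.refl = refl
lemma2 K conjecture p x 0<p 0<x (suc n) =
  (_ , postpone-postponing 0 (bestPolicy 0 0 _ (suc n)) , adaptive-optimal) ,
  nonAdaptive-optimal n (proj₂ (conjecture p x 0<p 0<x (suc n))) ,
  λ {c} {d} {e} {f} _ → ratio≈ratio′ c d e f
  where
  open Delay K p x 0<p 0<x
  open Adaptive n using (bestPolicy; adaptive-optimal; ratio≈ratio′)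
  open NonAdaptiveOptimality K p x 0<p 0<x
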